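{- Let $n,m\ge 1$. The number of plane labelled bipartite trees with $n$ white vertices and $m$ black vertices is $$\frac{\bigl((n+m-2)!\bigr)^2}{(n-1)!\,(m-1)!}.$$
   Context: A plane tree is a tree embedded in the plane, considered up to orientation-preserving homeomorphisms of the plane. A bipartite tree is a tree whose vertices are coloured black and white so that adjacent vertices have different colours. A plane labelled bipartite tree with $n$ white and $m$ black vertices is a plane bipartite tree whose white vertices carry the distinct labels $v_1,\dots,v_n$ and whose black vertices carry the distinct labels $u_1,\dots,u_m$ (the two label sets are disjoint). Two such trees are identified if there is an orientation-preserving homeomorphism of the plane carrying one to the other and preserving colours and labels. -}

module Defs where

open import Data.Nat using (ℕ; zero; suc; _+_; _*_; _∸_; _^_; _/_; _≤_)
open import Data.Nat.Properties using (_!*_!≢0)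
open import Data.Nat.Base using (_!)
open import Data.Fin using (Fin)
open import Data.Vec using (Vec; lookup)
open import Data.Bool using (Bool; T)
open import Data.Sum using (_⊎_; inj₁; inj₂)
open import Data.Product using (_×_; ∃)
open import Data.Empty using (⊥)
open import Data.List using (List; []; _∷_; _++_; length)
open import Data.List.Relation.Unary.Linked using (Linked)
open import Data.List.Relation.Unary.Unique.Propositional using (Unique)
open import Data.Refinement using (Refinement)
open import Function using (_∘_)
open import Relation.Nullary using (¬_)
open import Relation.Binary.PropositionalEquality using (_≡_)

module Graph {V : Set} (Adj : V → V → Set) where

  data Walk : V → V → Set where
    [] : ∀ {x} → Walk x x
    _∷_ : ∀ {x y z} → Adj x y → Walk y z → Walk x z

  Connected : Set
  Connected = ∀ x y → Walk x y

  record Cycle : Set where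
    field
      start   : V
      rest    : List V
      long    : 2 ≤ length rest
      distinct : Unique (start ∷ rest)
      closed  : Linked Adj (start ∷ rest ++ start ∷ [])

  Acyclic : Set
  Acyclic = ¬ Cycle

  IsTree : Set
  IsTree = Connected × Acyclic

-- Cyclic orders: a cyclic order on the subset N ⊆ Fin k is encoded by its
-- successor map σ (a single cycle on N), normalised to be the identity
-- outside N.

iter : ∀ {A : Set} → (A → A) → ℕ → A → A
iter f zero    x = x
iter f (suc t) x = f (iter f t x)

IsCyclicOrderOn : ∀ {k} → (Fin k → Set) → (Fin k → Fin k) → Set
IsCyclicOrderOn N σ =
  (∀ x → ¬ N x → σ x ≡ x) ×
  (∀ x → N x → N (σ x)) ×
  (∀ x y → N x → N y → ∃ λ t → iter σ t x ≡ y)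

-- Plane labelled bipartite trees with n white vertices v₁…vₙ (indexed by
-- Fin n) and m black vertices u₁…uₘ (indexed by Fin m).
-- Since all vertices carry distinct labels, an orientation-preserving
-- homeomorphism preserving colours and labels fixes every vertex, so a
-- plane labelled tree is exactly: a labelled bipartite tree together
-- with a rotation system (counterclockwise cyclic order of the
-- neighbours around each vertex).

record RawPlaneBipartite (n m : ℕ) : Set where
  constructor mkRaw
  field
    adj  : Vec (Vec Bool m) n
    rotW : Vec (Vec (Fin m) m) n
    rotB : Vec (Vec (Fin n) n) m

module _ {n m : ℕ} (r : RawPlaneBipartite n m) where
  open RawPlaneBipartite r

  Edge : Fin n → Fin m → Set
  Edge i j = T (lookup (lookup adj i) j)

  Adj : Fin n ⊎ Fin m → Fin n ⊎ Fin m → Set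
  Adj (inj₁ i) (inj₁ i′) = ⊥
  Adj (inj₁ i) (inj₂ j)  = Edge i j
  Adj (inj₂ j) (inj₁ i)  = Edge i j
  Adj (inj₂ j) (inj₂ j′) = ⊥

  IsPlaneBipartiteTree : Set
  IsPlaneBipartiteTree =
    Graph.IsTree Adj ×
    (∀ i → IsCyclicOrderOn (Edge i) (lookup (lookup rotW i))) ×
    (∀ j → IsCyclicOrderOn (λ i → Edge i j) (lookup (lookup rotB j)))

-- the type of plane labelled bipartite trees (proofs are irrelevant, so
-- two such trees are equal iff their underlying data are equal)
PlaneLabelledBipartiteTree : ℕ → ℕ → Set
PlaneLabelledBipartiteTree n m =
  Refinement (RawPlaneBipartite n m) IsPlaneBipartiteTree

treeCount : ℕ → ℕ → ℕ
treeCount n m =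
  _/_ (((n + m ∸ 2) !) ^ 2) ((n ∸ 1) ! * (m ∸ 1) !) {{(n ∸ 1) !* (m ∸ 1) !≢0}}

{-# OPTIONS --safe #-}

-- A plane tree on the vertices of positive degree, with prescribed degrees d on w white and e on b black
-- vertices, can be chosen in exactly (w − 1)! (b − 1)! ways, provided both degree sums are w + b − 1. Indeed if
-- b ≤ w, then some white vertex i is a leaf; it hangs in one of the e j − 1 corners of a black vertex j of the
-- tree without i, and Σ (e j − 1) = w − 1. The case w < b is symmetric. The degree sums of a tree are found
-- by deleting leaves as well. The degrees minus one form two weak compositions, of m − 1 into n parts and of
-- n − 1 into m parts, so the total is C(n+m−2, n−1) C(n+m−2, m−1) (n−1)! (m−1)!.
module Submission where

open import Defs
open import Data.Bool as Bool using (Bool; true; false; T; T?; if_then_else_)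
open import Data.Bool.Properties using (T-irrelevant)
open import Data.Empty using (⊥-elim)
open import Data.Fin using (Fin; zero; suc; join; punchOut; splitAt)
open import Data.Fin.Properties using (any?; injective⇒≤; punchOut-injective; splitAt-join; +↔⊎; *↔×; 0↔⊥; 1↔⊤)
  renaming (_≟_ to _≟ᶠ_)
open import Data.Irrelevant using ([_])
open import Data.List as List using (List; []; _∷_; _++_; length)
import Data.List.Membership.DecPropositional as DecMembership
open import Data.List.Membership.Propositional using (_∈_)
open import Data.List.Membership.Propositional.Properties using (∈-lookup)
open import Data.List.Properties using (map-++; length-map)
open import Data.List.Relation.Unary.All as All using (All; []; _∷_)
import Data.List.Relation.Unary.All.Properties as All
open import Data.List.Relation.Unary.AllPairs using ([]; _∷_)
open import Data.List.Relation.Unary.Any using (here; there)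
open import Data.List.Relation.Unary.Linked as Linked using (Linked; []; [-]; _∷_)
import Data.List.Relation.Unary.Linked.Properties as Linked
open import Data.List.Relation.Unary.Unique.Propositional using (Unique)
import Data.List.Relation.Unary.Unique.Propositional.Properties as Unique
open import Data.Nat
open import Data.Nat.DivMod using (m*n/n≡m)
open import Data.Nat.Properties
open import Data.Nat.Tactic.RingSolver using (solve-∀)
open import Data.Product using (Σ; ∃; ∃₂; _×_; _,_; proj₁; proj₂)
open import Data.Product.Function.Dependent.Propositional using () renaming (cong to Σ-cong)
open import Data.Product.Function.NonDependent.Propositional using (_×-cong_)
open import Data.Refinement using (Refinement; _,_; value)
open import Data.Sum as Sum using (_⊎_; inj₁; inj₂)
open import Data.Sum.Function.Propositional using (_⊎-cong_)
open import Data.Sum.Properties using (inj₁-injective; inj₂-injective; swap-involutive) renaming (≡-dec to ⊎-≡-dec)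
open import Data.Vec using (Vec; []; _∷_; allFin; lookup; replicate; tabulate; updateAt; _[_]≔_)
open import Data.Vec.Functional using () renaming (updateAt to updateAtᶠ)
open import Data.Vec.Functional.Properties using ()
  renaming (updateAt-updates to updateAtᶠ-updates; updateAt-minimal to updateAtᶠ-minimal)
open import Data.Vec.Properties
  using (lookup-allFin; lookup-replicate; lookup∘tabulate; lookup∘updateAt; lookup∘updateAt′; tabulate-cong;
      tabulate∘lookup)
  renaming (≡-dec to Vec-≡-dec)
open import Function using (_∘_; _↔_; const; id; mk↔ₛ′)
open import Function.Properties.Inverse using (↔-trans)
open import Relation.Binary.Definitions using (DecidableEquality; Symmetric)
open import Relation.Binary.PropositionalEquality
open import Relation.Nullary using (Dec; yes; no; does; ¬_; contradiction)
open import Relation.Nullary.Decidable using (decidable-stable; fromWitness; map′; recompute; toWitness; ⌊_⌋; _×-dec_)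
open import Relation.Nullary.Recomputable using (⊥-recompute)
open import Relation.Unary using (Decidable)
open import Algebra.Properties.CommutativeMonoid.Sum +-0-commutativeMonoid
  using (sum; sum-cong-≗; sum-replicate-zero; ∑-distrib-+)

open Graph using (Walk; []; _∷_; Cycle; Acyclic)
open RawPlaneBipartite

-- The index sets `Fin n` and `Fin m` never shrink: a deleted vertex stays as a vertex of degree 0,
-- whose rotation is forced to be the identity. The induction thus runs on the numbers of vertices
-- of positive degree, without relabelling. Prescribing the degrees makes leaf deletion reversible:
-- the leaf `i` depends on `d` alone, so no tree is counted once for each of its leaves. It exists
-- because white degrees all at least 2 would give a sum of at least 2w, more than w + b - 1. A
-- corner at `j` is recorded by the neighbour that follows the new leaf in the rotation at `j`. The
-- sum of the `e j − 1` is the number of edges minus the number of black vertices; a `j` with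
-- `e j = 1` rightly contributes nothing, since `i` and `j` would form a component of their own
-- while another white vertex is present. Proofs inside a `Refinement` are erased, so each bijection
-- has to recompute its witnesses and equations from decidable data.

-- Sums and supports of functions on finite sets

sum-bump : ∀ {n} {f g : Fin n → ℕ} i → f i ≡ suc (g i) → (∀ x → x ≢ i → f x ≡ g x) → sum f ≡ suc (sum g)
sum-bump zero fi≡ f≗g = cong₂ _+_ fi≡ (sum-cong-≗ λ x → f≗g (suc x) λ ())
sum-bump {g = g} (suc i) fi≡ f≗g =
  trans (cong₂ _+_ (f≗g zero λ ()) (sum-bump i fi≡ λ x x≢i → f≗g (suc x) λ { refl → x≢i refl }))
        (+-suc (g zero) _)

sum-pos : ∀ {n} (f : Fin n → ℕ) i → f i ≤ sum f
sum-pos f zero    = m≤m+n _ _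
sum-pos f (suc i) = ≤-trans (sum-pos (f ∘ suc) i) (m≤n+m _ _)

sum-zero : ∀ {n} {f : Fin n → ℕ} → (∀ i → f i ≡ 0) → sum f ≡ 0
sum-zero {zero}  f≡0 = refl
sum-zero {suc n} f≡0 = cong₂ _+_ (f≡0 zero) (sum-zero (f≡0 ∘ suc))

sum-mono : ∀ {n} {f g : Fin n → ℕ} → (∀ i → f i ≤ g i) → sum f ≤ sum g
sum-mono {zero}  f≤g = z≤n
sum-mono {suc n} f≤g = +-mono-≤ (f≤g zero) (sum-mono (f≤g ∘ suc))

sum-suc : ∀ {n} (f : Fin n → ℕ) → sum (suc ∘ f) ≡ n + sum f
sum-suc {zero}  f = refl
sum-suc {suc n} f = cong suc (trans (cong (f zero +_) (sum-suc (f ∘ suc))) (m+n+o-comm (f zero) n (sum (f ∘ suc))))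
  where
  m+n+o-comm : ∀ x y z → x + (y + z) ≡ y + (x + z)
  m+n+o-comm = solve-∀

sum-*ʳ : ∀ {n} (f : Fin n → ℕ) c → sum (λ i → f i * c) ≡ sum f * c
sum-*ʳ {zero}  f c = refl
sum-*ʳ {suc n} f c = trans (cong (f zero * c +_) (sum-*ʳ (f ∘ suc) c)) (sym (*-distribʳ-+ c (f zero) _))

sum-witness : ∀ {n} (f : Fin n → ℕ) {k} → sum f ≡ suc k → ∃ λ i → f i ≢ 0
sum-witness {suc n} f eq with f zero in eq₀
... | suc _ = zero , λ f₀≡0 → 1+n≢0 (trans (sym eq₀) f₀≡0)
... | zero  = let i , fi≢0 = sum-witness (f ∘ suc) eq in suc i , fi≢0

positive : ℕ → ℕ
positive zero    = 0
positive (suc _) = 1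

support : ∀ {n} → (Fin n → ℕ) → ℕ
support f = sum (positive ∘ f)

sum-pred : ∀ {n} (f : Fin n → ℕ) → sum (λ i → f i ∸ 1) + support f ≡ sum f
sum-pred f = trans (sym (∑-distrib-+ _ (positive ∘ f))) (sum-cong-≗ λ i → pred+positive (f i))
  where
  pred+positive : ∀ k → k ∸ 1 + positive k ≡ k
  pred+positive zero    = refl
  pred+positive (suc k) = +-comm k 1

-- Were 1 never attained, every positive value would be at least 2 and the sum at least twice the
-- support. Applied to degrees, this produces a leaf.
sum<2*support⇒∃1 : ∀ {n} (f : Fin n → ℕ) → sum f < support f + support f → ∃ λ i → f i ≡ 1
sum<2*support⇒∃1 f lt with any? (λ i → f i ≟ 1)
... | yes ∃1 = ∃1
... | no ∄1  = contradiction lt (≤⇒≯ (subst (_≤ sum f) (∑-distrib-+ (positive ∘ f) (positive ∘ f)) (sum-mono twice≤)))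
  where
  twice≤ : ∀ i → positive (f i) + positive (f i) ≤ f i
  twice≤ i with f i in eq
  ... | 0           = z≤n
  ... | 1           = ⊥-elim (∄1 (i , eq))
  ... | suc (suc _) = s≤s (s≤s z≤n)

-- Counting Boolean predicates

toℕᵇ : Bool → ℕ
toℕᵇ b = if b then 1 else 0

count : ∀ {n} → (Fin n → Bool) → ℕ
count p = sum (toℕᵇ ∘ p)

T⇒≡true : ∀ {b} → T b → b ≡ true
T⇒≡true {true} _ = refl

¬T⇒≡false : ∀ {b} → ¬ T b → b ≡ false
¬T⇒≡false {false} _  = refl
¬T⇒≡false {true}  ¬t = ⊥-elim (¬t _)

T⇔⇒≡ : ∀ {a b} → (T a → T b) → (T b → T a) → a ≡ b
T⇔⇒≡ {true}  f g = sym (T⇒≡true (f _))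
T⇔⇒≡ {false} f g = sym (¬T⇒≡false g)

count-witness : ∀ {n} (p : Fin n → Bool) → count p ≢ 0 → ∃ (T ∘ p)
count-witness p ≢0 with count p in eq
... | zero  = ⊥-elim (≢0 refl)
... | suc k with sum-witness (toℕᵇ ∘ p) eq
...   | i , pi≢0 = i , lem (p i) pi≢0
  where
  lem : ∀ b → toℕᵇ b ≢ 0 → T b
  lem false ≢0 = ⊥-elim (≢0 refl)
  lem true  _  = _

count≢0 : ∀ {n} (p : Fin n → Bool) i → T (p i) → count p ≢ 0
count≢0 p i pi eq = n≮0 (subst₂ _≤_ (cong toℕᵇ (T⇒≡true pi)) eq (sum-pos (toℕᵇ ∘ p) i))

count-bump : ∀ {n} {p q : Fin n → Bool} i → T (p i) → ¬ T (q i) → (∀ x → x ≢ i → p x ≡ q x) → count p ≡ suc (count q)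
count-bump i pi ¬qi p≗q = sum-bump i
  (trans (cong toℕᵇ (T⇒≡true pi)) (cong (suc ∘ toℕᵇ) (sym (¬T⇒≡false ¬qi))))
  λ x x≢i → cong toℕᵇ (p≗q x x≢i)

module _ {n : ℕ} (p : Fin n → Bool) (i : Fin n) where

  private
    -- Erasing `i` lowers the count by one when `p i` holds, so the facts below reduce to whether
    -- the erased predicate still has a witness.
    except : Fin n → Bool
    except x = if does (x ≟ᶠ i) then false else p x

    except-i : ¬ T (except i)
    except-i t with i ≟ᶠ i
    ... | yes _  = t
    ... | no i≢i = i≢i refl

    except-other : ∀ x → x ≢ i → p x ≡ except x
    except-other x x≢i with x ≟ᶠ i
    ... | yes x≡i = ⊥-elim (x≢i x≡i)
    ... | no _    = refl

  count≡1⇒unique : count p ≡ 1 → T (p i) → ∀ x → T (p x) → x ≡ i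
  count≡1⇒unique eq pi x px with x ≟ᶠ i
  ... | yes x≡i = x≡i
  ... | no x≢i  = ⊥-elim (count≢0 except x (subst T (except-other x x≢i) px)
    (suc-injective (trans (sym (count-bump i pi except-i except-other)) eq)))

  count≢1⇒another : count p ≢ 1 → T (p i) → ∃ λ x → x ≢ i × T (p x)
  count≢1⇒another ≢1 pi with count-witness except (λ eq →
      ≢1 (trans (count-bump i pi except-i except-other) (cong suc eq)))
  ... | x , t = x , x≢i , subst T (sym (except-other x x≢i)) t
    where
    x≢i : x ≢ i
    x≢i refl = except-i t

  unique⇒count≡1 : T (p i) → (∀ x → T (p x) → x ≡ i) → count p ≡ 1
  unique⇒count≡1 pi uniq with count p ≟ 1
  ... | yes eq = eq
  ... | no ≢1  = let x , x≢i , px = count≢1⇒another ≢1 pi in ⊥-elim (x≢i (uniq x px))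

-- Bijections with finite types, and refinements with erased proofs

Fin-Σ : ∀ {n} {B : Fin n → Set} (c : Fin n → ℕ) → (∀ i → Fin (c i) ↔ B i) → Fin (sum c) ↔ Σ (Fin n) B
Fin-Σ {zero}  c c↔ = mk↔ₛ′ (λ ()) (λ ()) (λ ()) λ ()
Fin-Σ {suc n} {B} c c↔ = ↔-trans +↔⊎ (↔-trans (c↔ zero ⊎-cong Fin-Σ (c ∘ suc) (c↔ ∘ suc)) split)
  where
  split : (B zero ⊎ Σ (Fin n) (B ∘ suc)) ↔ Σ (Fin (suc n)) B
  split = mk↔ₛ′ (λ { (inj₁ b) → zero , b ; (inj₂ (i , b)) → suc i , b })
                (λ { (zero , b) → inj₁ b ; (suc i , b) → inj₂ (i , b) })
                (λ { (zero , b) → refl ; (suc i , b) → refl })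
                (λ { (inj₁ b) → refl ; (inj₂ (i , b)) → refl })

Fin-Σ-const : ∀ {A : Set} {B : A → Set} {k c} → Fin k ↔ A → (∀ a → Fin c ↔ B a) → Fin (k * c) ↔ Σ A B
Fin-Σ-const k↔ c↔ = ↔-trans *↔× (Σ-cong k↔ (c↔ _))

Fin-T : ∀ b → Fin (toℕᵇ b) ↔ T b
Fin-T true  = 1↔⊤
Fin-T false = 0↔⊥

Fin-count : ∀ {n} (p : Fin n → Bool) → Fin (count p) ↔ Σ (Fin n) (T ∘ p)
Fin-count p = Fin-Σ (toℕᵇ ∘ p) (Fin-T ∘ p)

Fin-subst : ∀ {A : Set} {k l} → k ≡ l → Fin k ↔ A → Fin l ↔ A
Fin-subst refl k↔ = k↔

Fin-0 : ∀ {A : Set} → ¬ A → Fin 0 ↔ A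
Fin-0 ¬a = mk↔ₛ′ (λ ()) (⊥-elim ∘ ¬a) (λ a → ⊥-elim (¬a a)) λ ()

refinement-≡ : ∀ {A : Set} {P : A → Set} {x y : Refinement A P} → value x ≡ value y → x ≡ y
refinement-≡ {x = _ , _} {y = _ , _} refl = refl

-- The round trips are identities only under `P` and `Q`, whose proofs are erased; decidable
-- equality lets `recompute` extract the equation between the underlying data.
refinement-↔ : ∀ {A B : Set} {P : A → Set} {Q : B → Set} → DecidableEquality A → DecidableEquality B →
  (f : A → B) (g : B → A) → (∀ a → P a → Q (f a)) → (∀ b → Q b → P (g b)) →
  (∀ b → Q b → f (g b) ≡ b) → (∀ a → P a → g (f a) ≡ a) → Refinement A P ↔ Refinement B Q
refinement-↔ _≟ᴬ_ _≟ᴮ_ f g P⇒Q Q⇒P f∘g g∘f = mk↔ₛ′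
  (λ (a , [ p ]) → f a , [ P⇒Q a p ])
  (λ (b , [ q ]) → g b , [ Q⇒P b q ])
  (λ (b , [ q ]) → refinement-≡ (recompute (f (g b) ≟ᴮ b) (f∘g b q)))
  (λ (a , [ p ]) → refinement-≡ (recompute (g (f a) ≟ᴬ a) (g∘f a p)))

-- The proof that a block exists is erased, so its index is searched for; uniqueness of `j` makes
-- the search return the original index.
partition : ∀ {A : Set} {P : A → Set} {k} (Q : Fin k → A → Set) → (∀ j a → Dec (Q j a)) →
  (∀ a → P a → ∃ λ j → Q j a) → (∀ a → P a → ∀ j j′ → Q j a → Q j′ a → j ≡ j′) →
  (Σ (Fin k) λ j → Refinement A λ a → P a × Q j a) ↔ Refinement A P
partition {A} {P} {k} Q Q? ex uniq = mk↔ₛ′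
  (λ (j , (a , [ pq ])) → a , [ proj₁ pq ])
  (λ (a , [ p ]) → let j , q = find a p in j , (a , [ p , q ]))
  (λ _ → refl)
  (λ (j , (a , [ pq ])) → part-≡ (recompute (proj₁ (find a (proj₁ pq)) ≟ᶠ j)
    (uniq a (proj₁ pq) _ j (proj₂ (find a (proj₁ pq))) (proj₂ pq))))
  where
  find : ∀ a → .(P a) → ∃ λ j → Q j a
  find a p = recompute (any? λ j → Q? j a) (ex a p)
  part-≡ : ∀ {j j′ a} .{pq : P a × Q j a} .{pq′ : P a × Q j′ a} → j ≡ j′ →
    _≡_ {A = Σ (Fin k) λ j → Refinement A λ a → P a × Q j a} (j , (a , [ pq ])) (j′ , (a , [ pq′ ]))
  part-≡ refl = refl

-- Finite self-maps, orbits and cyclic orders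

injective⇒surjective : ∀ {n} (f : Fin n → Fin n) → (∀ {x y} → f x ≡ f y → x ≡ y) → ∀ y → ∃ λ x → f x ≡ y
injective⇒surjective {suc n} f f-inj y with any? (λ x → f x ≟ᶠ y)
... | yes ∃x = ∃x
... | no ∄x  = ⊥-elim (1+n≰n (injective⇒≤ {f = λ x → punchOut (y≢f x)} λ {a} {b} eq →
    f-inj (punchOut-injective (y≢f a) (y≢f b) eq)))
  where
  y≢f : ∀ x → y ≢ f x
  y≢f x y≡fx = ∄x (x , sym y≡fx)

-- A section of `f` is injective, hence surjective by the pigeonhole principle, so every argument of
-- `f` is a chosen preimage.
surjective⇒injective : ∀ {n} (f : Fin n → Fin n) → (∀ y → ∃ λ x → f x ≡ y) → ∀ {x y} → f x ≡ f y → x ≡ y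
surjective⇒injective f f-surj {x} {y} fx≡fy
  with injective⇒surjective g g-inj x | injective⇒surjective g g-inj y
  where
  g = proj₁ ∘ f-surj
  g-inj : ∀ {a b} → g a ≡ g b → a ≡ b
  g-inj {a} {b} eq = trans (sym (proj₂ (f-surj a))) (trans (cong f eq) (proj₂ (f-surj b)))
... | a , refl | b , refl = cong (proj₁ ∘ f-surj) (trans (sym (proj₂ (f-surj a))) (trans fx≡fy (proj₂ (f-surj b))))

iter-suc : ∀ {A : Set} (f : A → A) t x → iter f t (f x) ≡ iter f (suc t) x
iter-suc f zero    x = refl
iter-suc f (suc t) x = cong f (iter-suc f t x)

-- `Orbit f y x` means that `y` is reached from `x`. Steps are peeled off at the start, whereas
-- `iter` peels them off at the end; this allows recursion along the path.
data Orbit {A : Set} (f : A → A) (y : A) : A → Set where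
  here : Orbit f y y
  step : ∀ {x} → Orbit f y (f x) → Orbit f y x

orbit-trans : ∀ {A : Set} {f : A → A} {x y z} → Orbit f y x → Orbit f z y → Orbit f z x
orbit-trans here     o = o
orbit-trans (step p) o = step (orbit-trans p o)

fromIter : ∀ {A : Set} {f : A → A} t {x y} → iter f t x ≡ y → Orbit f y x
fromIter         zero    refl = here
fromIter {f = f} (suc t) {x} eq   = step (fromIter t (trans (iter-suc f t x) eq))

toIter : ∀ {A : Set} {f : A → A} {x y} → Orbit f y x → ∃ λ t → iter f t x ≡ y
toIter here = 0 , refl
toIter {f = f} {x} (step o) = let t , eq = toIter o in suc t , trans (sym (iter-suc f t x)) eq

cyclic-resp : ∀ {k} {N N′ : Fin k → Set} {σ σ′ : Fin k → Fin k} → (∀ x → N x → N′ x) → (∀ x → N′ x → N x) → σ ≗ σ′ →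
  IsCyclicOrderOn N σ → IsCyclicOrderOn N′ σ′
cyclic-resp {N = N} {N′} {σ} {σ′} to from σ≗σ′ (fix , closed , trn) =
    (λ x ¬N′ → trans (sym (σ≗σ′ x)) (fix x (¬N′ ∘ to x)))
  , (λ x N′x → subst N′ (σ≗σ′ x) (to _ (closed x (from x N′x))))
  , λ x y N′x N′y → let t , eq = trn x y (from x N′x) (from y N′y) in t , trans (sym (iter-cong t)) eq
  where
  iter-cong : ∀ t {x} → iter σ t x ≡ iter σ′ t x
  iter-cong zero        = refl
  iter-cong (suc t) {x} = trans (σ≗σ′ _) (cong σ′ (iter-cong t))

module _ {k : ℕ} {N : Fin k → Set} (N? : Decidable N) {σ : Fin k → Fin k} (cyclic : IsCyclicOrderOn N σ) where

  private
    fix    = proj₁ cyclic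
    closed = proj₁ (proj₂ cyclic)
    trn    = proj₂ (proj₂ cyclic)

  -- The orbit of `σ y` returns to `y`; the point reached from `y` in the same number of steps is
  -- the one before `y`.
  cyclic-predecessor : ∀ y → N y → ∃ λ x → N x × σ x ≡ y
  cyclic-predecessor y Ny with trn (σ y) y (closed y Ny) Ny
  ... | t , eq = iter σ t y , closed-iter t , trans (sym (iter-suc σ t y)) eq
    where
    closed-iter : ∀ t → N (iter σ t y)
    closed-iter zero    = Ny
    closed-iter (suc t) = closed _ (closed-iter t)

  -- Points of `N` have predecessors and all other points are their own preimages, so `σ` is
  -- surjective on a finite set.
  cyclic-injective : ∀ {x y} → σ x ≡ σ y → x ≡ y
  cyclic-injective = surjective⇒injective σ surj
    where
    surj : ∀ y → ∃ λ x → σ x ≡ y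
    surj y with N? y
    ... | yes Ny = let x , _ , eq = cyclic-predecessor y Ny in x , eq
    ... | no ¬Ny = y , fix y ¬Ny

  cyclic-∉ : ∀ {i} → ¬ N i → ∀ x → x ≢ i → σ x ≢ i
  cyclic-∉ ¬Ni x x≢i σx≡i = x≢i (cyclic-injective (trans σx≡i (sym (fix _ ¬Ni))))

  cyclic-moves : ∀ {i z} → N i → N z → z ≢ i → σ i ≢ i
  cyclic-moves {i} {z} Ni Nz z≢i σi≡i = let t , eq = trn i z Ni Nz in z≢i (trans (sym eq) (stuck t))
    where
    stuck : ∀ t → iter σ t i ≡ i
    stuck zero    = refl
    stuck (suc t) = trans (cong σ (stuck t)) σi≡i

cyclic-id : ∀ {k} {N : Fin k → Set} {σ : Fin k → Fin k} → σ ≗ (λ x → x) → (∀ x y → N x → N y → x ≡ y) →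
    IsCyclicOrderOn N σ
cyclic-id {N = N} σ≗id N-prop =
    (λ x _ → σ≗id x)
  , (λ x Nx → subst N (sym (σ≗id x)) Nx)
  , λ x y Nx Ny → 0 , N-prop x y Nx Ny

cyclic-singleton : ∀ {k} {N : Fin k → Set} → Decidable N → ∀ {σ : Fin k → Fin k} → IsCyclicOrderOn N σ →
  (∀ x y → N x → N y → x ≡ y) → σ ≗ (λ x → x)
cyclic-singleton N? (fix , closed , _) N-prop x with N? x
... | yes Nx = N-prop _ _ (closed x Nx) Nx
... | no ¬Nx = fix x ¬Nx

opaque

  -- Deletion of `i` from its cycle. Afterwards `i` is fixed, as the normalisation of cyclic orders
  -- demands. Being opaque, it is used only through its three equations below.
  spliceOut : ∀ {k} → Fin k → (Fin k → Fin k) → Fin k → Fin k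
  spliceOut i σ x with x ≟ᶠ i
  ... | yes _ = i
  ... | no _  with σ x ≟ᶠ i
  ...   | yes _ = σ i
  ...   | no _  = σ x

  -- The element `z` names a corner: `i` is placed directly before `z`, between `z` and its
  -- predecessor.
  spliceIn : ∀ {k} → Fin k → Fin k → (Fin k → Fin k) → Fin k → Fin k
  spliceIn i z σ x with x ≟ᶠ i
  ... | yes _ = z
  ... | no _  with σ x ≟ᶠ z
  ...   | yes _ = i
  ...   | no _  = σ x

  spliceOut-self : ∀ {k} {i : Fin k} {σ : Fin k → Fin k} → spliceOut i σ i ≡ i
  spliceOut-self {i = i} with i ≟ᶠ i
  ... | yes _  = refl
  ... | no i≢i = ⊥-elim (i≢i refl)

  spliceOut-before : ∀ {k} {i : Fin k} {σ : Fin k → Fin k} {x} → x ≢ i → σ x ≡ i → spliceOut i σ x ≡ σ i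
  spliceOut-before {i = i} {σ} {x} x≢i σx≡i with x ≟ᶠ i
  ... | yes x≡i = ⊥-elim (x≢i x≡i)
  ... | no _  with σ x ≟ᶠ i
  ...   | yes _ = refl
  ...   | no σx≢i = ⊥-elim (σx≢i σx≡i)

  spliceOut-other : ∀ {k} {i : Fin k} {σ : Fin k → Fin k} {x} → x ≢ i → σ x ≢ i → spliceOut i σ x ≡ σ x
  spliceOut-other {i = i} {σ} {x} x≢i σx≢i with x ≟ᶠ i
  ... | yes x≡i = ⊥-elim (x≢i x≡i)
  ... | no _  with σ x ≟ᶠ i
  ...   | yes σx≡i = ⊥-elim (σx≢i σx≡i)
  ...   | no _ = refl

  spliceIn-self : ∀ {k} {i z : Fin k} {σ : Fin k → Fin k} → spliceIn i z σ i ≡ z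
  spliceIn-self {i = i} with i ≟ᶠ i
  ... | yes _  = refl
  ... | no i≢i = ⊥-elim (i≢i refl)

  spliceIn-before : ∀ {k} {i z : Fin k} {σ : Fin k → Fin k} {x} → x ≢ i → σ x ≡ z → spliceIn i z σ x ≡ i
  spliceIn-before {i = i} {z} {σ} {x} x≢i σx≡z with x ≟ᶠ i
  ... | yes x≡i = ⊥-elim (x≢i x≡i)
  ... | no _  with σ x ≟ᶠ z
  ...   | yes _ = refl
  ...   | no σx≢z = ⊥-elim (σx≢z σx≡z)

  spliceIn-other : ∀ {k} {i z : Fin k} {σ : Fin k → Fin k} {x} → x ≢ i → σ x ≢ z → spliceIn i z σ x ≡ σ x
  spliceIn-other {i = i} {z} {σ} {x} x≢i σx≢z with x ≟ᶠ i
  ... | yes x≡i = ⊥-elim (x≢i x≡i)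
  ... | no _  with σ x ≟ᶠ z
  ...   | yes σx≡z = ⊥-elim (σx≢z σx≡z)
  ...   | no _ = refl

spliceOut-cong : ∀ {k} {i : Fin k} {σ τ : Fin k → Fin k} → σ ≗ τ → spliceOut i σ ≗ spliceOut i τ
spliceOut-cong {i = i} {σ} {τ} σ≗τ x = by-cases (x ≟ᶠ i) (τ x ≟ᶠ i)
  where
  by-cases : Dec (x ≡ i) → Dec (τ x ≡ i) → spliceOut i σ x ≡ spliceOut i τ x
  by-cases (yes refl) _ = trans (spliceOut-self {σ = σ}) (sym (spliceOut-self {σ = τ}))
  by-cases (no x≢i) (yes τx≡i) =
      trans (spliceOut-before x≢i (trans (σ≗τ x) τx≡i)) (trans (σ≗τ i) (sym (spliceOut-before x≢i τx≡i)))
  by-cases (no x≢i) (no τx≢i) =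
      trans (spliceOut-other x≢i (τx≢i ∘ trans (sym (σ≗τ x)))) (trans (σ≗τ x) (sym (spliceOut-other x≢i τx≢i)))

spliceIn-cong : ∀ {k} {i z : Fin k} {σ τ : Fin k → Fin k} → σ ≗ τ → spliceIn i z σ ≗ spliceIn i z τ
spliceIn-cong {i = i} {z} {σ} {τ} σ≗τ x = by-cases (x ≟ᶠ i) (τ x ≟ᶠ z)
  where
  by-cases : Dec (x ≡ i) → Dec (τ x ≡ z) → spliceIn i z σ x ≡ spliceIn i z τ x
  by-cases (yes refl) _         = trans (spliceIn-self {σ = σ}) (sym (spliceIn-self {σ = τ}))
  by-cases (no x≢i) (yes τx≡z) = trans (spliceIn-before x≢i (trans (σ≗τ x) τx≡z)) (sym (spliceIn-before x≢i τx≡z))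
  by-cases (no x≢i) (no τx≢z)  =
      trans (spliceIn-other x≢i (τx≢z ∘ trans (sym (σ≗τ x)))) (trans (σ≗τ x) (sym (spliceIn-other x≢i τx≢z)))

module _ {k : ℕ} {N : Fin k → Set} (N? : Decidable N) {σ : Fin k → Fin k} (cyclic : IsCyclicOrderOn N σ) {i : Fin k}
    where

  private
    fix    = proj₁ cyclic
    closed = proj₁ (proj₂ cyclic)
    trn    = proj₂ (proj₂ cyclic)

  -- Transitivity survives because each passage through `i` in an orbit of `σ` contracts to one
  -- step; `σ i ≢ i` makes the orbit leave `i` at once.
  spliceOut-cyclic : N i → σ i ≢ i → IsCyclicOrderOn (λ x → N x × x ≢ i) (spliceOut i σ)
  spliceOut-cyclic Ni σi≢i = fix′ , closed′ , λ x y (Nx , x≢i) (Ny , y≢i) →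
      toIter (shortcut y≢i (let t , eq = trn x y Nx Ny in fromIter t eq) x≢i)
    where
    fix′ : ∀ x → ¬ (N x × x ≢ i) → spliceOut i σ x ≡ x
    fix′ x ¬N′ with x ≟ᶠ i
    ... | yes refl = spliceOut-self
    ... | no x≢i = trans (spliceOut-other x≢i (x≢i ∘ trans (sym σx≡x))) σx≡x
      where σx≡x = fix x λ Nx → ¬N′ (Nx , x≢i)
    closed′ : ∀ x → N x × x ≢ i → N (spliceOut i σ x) × spliceOut i σ x ≢ i
    closed′ x (Nx , x≢i) with σ x ≟ᶠ i
    ... | yes σx≡i rewrite spliceOut-before {σ = σ} x≢i σx≡i = closed i Ni , σi≢i
    ... | no σx≢i  rewrite spliceOut-other {σ = σ} x≢i σx≢i  = closed x Nx , σx≢i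
    shortcut : ∀ {x y} → y ≢ i → Orbit σ y x → x ≢ i → Orbit (spliceOut i σ) y x
    shortcut-past : ∀ {x y} → y ≢ i → Orbit σ y x → x ≡ i → Orbit (spliceOut i σ) y (σ i)
    shortcut y≢i here x≢i = here
    shortcut {x} y≢i (step o) x≢i with σ x ≟ᶠ i
    ... | no σx≢i  = step (subst (Orbit _ _) (sym (spliceOut-other x≢i σx≢i)) (shortcut y≢i o σx≢i))
    ... | yes σx≡i = step (subst (Orbit _ _) (sym (spliceOut-before x≢i σx≡i)) (shortcut-past y≢i o σx≡i))
    shortcut-past y≢i here     y≡i  = ⊥-elim (y≢i y≡i)
    shortcut-past y≢i (step o) refl = shortcut y≢i o σi≢i

  -- Transitivity goes through `z`. A step of `σ` into `z` becomes a detour over `i`, so every point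
  -- still reaches `z`; and `z` reaches every point, `i` itself by way of the old predecessor of
  -- `z`.
  spliceIn-cyclic : ∀ {z} → ¬ N i → N z → IsCyclicOrderOn (λ x → N x ⊎ x ≡ i) (spliceIn i z σ)
  spliceIn-cyclic {z} ¬Ni Nz = fix′ , closed′ , λ x y N′x N′y → toIter (orbit-trans (to-z x N′x) (from-z y N′y))
    where
    fix′ : ∀ x → ¬ (N x ⊎ x ≡ i) → spliceIn i z σ x ≡ x
    fix′ x ¬N′ = trans (spliceIn-other (¬N′ ∘ inj₂) σx≢z) σx≡x
      where
      σx≡x = fix x (¬N′ ∘ inj₁)
      σx≢z : σ x ≢ z
      σx≢z eq = ¬N′ (inj₁ (subst N (trans (sym eq) σx≡x) Nz))
    closed′ : ∀ x → N x ⊎ x ≡ i → N (spliceIn i z σ x) ⊎ spliceIn i z σ x ≡ i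
    closed′ x (inj₂ refl) = inj₁ (subst N (sym spliceIn-self) Nz)
    closed′ x (inj₁ Nx) with σ x ≟ᶠ z
    ... | yes σx≡z = inj₂ (spliceIn-before (λ { refl → ¬Ni Nx }) σx≡z)
    ... | no σx≢z  = inj₁ (subst N (sym (spliceIn-other (λ { refl → ¬Ni Nx }) σx≢z)) (closed x Nx))
    i→z : Orbit (spliceIn i z σ) z i
    i→z = step (subst (Orbit _ _) (sym spliceIn-self) here)
    lift : ∀ {x y} → N x → Orbit σ y x → Orbit (spliceIn i z σ) y x
    lift Nx here = here
    lift {x} Nx (step o) with σ x ≟ᶠ z
    ... | no σx≢z  = step (subst (Orbit _ _) (sym (spliceIn-other (λ { refl → ¬Ni Nx }) σx≢z)) (lift (closed x Nx) o))
    ... | yes σx≡z = step (subst (Orbit _ _) (sym (spliceIn-before (λ { refl → ¬Ni Nx }) σx≡z))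
      (orbit-trans i→z (subst (Orbit _ _) σx≡z (lift (closed x Nx) o))))
    to-z : ∀ x → N x ⊎ x ≡ i → Orbit (spliceIn i z σ) z x
    to-z x (inj₂ refl) = i→z
    to-z x (inj₁ Nx)   = lift Nx (let t , eq = trn x z Nx Nz in fromIter t eq)
    from-z : ∀ y → N y ⊎ y ≡ i → Orbit (spliceIn i z σ) y z
    from-z y (inj₁ Ny)   = lift Nz (let t , eq = trn z y Nz Ny in fromIter t eq)
    from-z y (inj₂ refl) = let p , Np , σp≡z = cyclic-predecessor N? cyclic z Nz in
      orbit-trans (lift Nz (let t , eq = trn z p Nz Np in fromIter t eq))
        (step (subst (Orbit _ _) (sym (spliceIn-before (λ { refl → ¬Ni Np }) σp≡z)) here))

  spliceOut∘spliceIn : ∀ {z} → ¬ N i → N z → spliceOut i (spliceIn i z σ) ≗ σ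
  spliceOut∘spliceIn {z} ¬Ni Nz x = by-cases (x ≟ᶠ i) (σ x ≟ᶠ z)
    where
    by-cases : Dec (x ≡ i) → Dec (σ x ≡ z) → spliceOut i (spliceIn i z σ) x ≡ σ x
    by-cases (yes refl) _ = trans (spliceOut-self {σ = spliceIn i z σ}) (sym (fix x ¬Ni))
    by-cases (no x≢i) (yes σx≡z) =
        trans (spliceOut-before x≢i (spliceIn-before x≢i σx≡z)) (trans (spliceIn-self {σ = σ}) (sym σx≡z))
    by-cases (no x≢i) (no σx≢z) =
        trans (spliceOut-other x≢i (subst (_≢ i) (sym eq) (cyclic-∉ N? cyclic ¬Ni x x≢i))) eq
      where eq = spliceIn-other x≢i σx≢z

  -- The point `i` is put back before its old successor. Injectivity of `σ` keeps every point other
  -- than the old predecessor of `i` from being redirected.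
  spliceIn∘spliceOut : spliceIn i (σ i) (spliceOut i σ) ≗ σ
  spliceIn∘spliceOut x = by-cases (x ≟ᶠ i) (σ x ≟ᶠ i)
    where
    by-cases : Dec (x ≡ i) → Dec (σ x ≡ i) → spliceIn i (σ i) (spliceOut i σ) x ≡ σ x
    by-cases (yes refl) _ = spliceIn-self {σ = spliceOut i σ}
    by-cases (no x≢i) (yes σx≡i) = trans (spliceIn-before x≢i (spliceOut-before x≢i σx≡i)) (sym σx≡i)
    by-cases (no x≢i) (no σx≢i) =
        trans (spliceIn-other x≢i (subst (_≢ σ i) (sym eq) λ σx≡σi → x≢i (cyclic-injective N? cyclic σx≡σi))) eq
      where eq = spliceOut-other x≢i σx≢i

-- Walks, cycles and leaves in graphs

module _ {V W : Set} {Adj : V → V → Set} {Adj′ : W → W → Set}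
  (f : V → W) (f-adj : ∀ x y → Adj x y → Adj′ (f x) (f y)) where

  walk-map : ∀ {x y} → Walk Adj x y → Walk Adj′ (f x) (f y)
  walk-map []      = []
  walk-map (a ∷ w) = f-adj _ _ a ∷ walk-map w

  acyclic-reflect : (∀ {x y} → f x ≡ f y → x ≡ y) → Acyclic Adj′ → Acyclic Adj
  acyclic-reflect f-inj acyclic c = acyclic record
    { start    = f start
    ; rest     = List.map f rest
    ; long     = subst (2 ≤_) (sym (length-map f rest)) long
    ; distinct = Unique.map⁺ f-inj distinct
    ; closed   = subst (Linked Adj′) (cong (f start ∷_) (map-++ f rest _))
        (Linked.map⁺ (Linked.map (f-adj _ _) closed))
    }
    where open Cycle c

module _ {V : Set} {Adj : V → V → Set} (adj-sym : Symmetric Adj) where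

  -- The entries before and after `u` serve. They could coincide only if `p` is the closing vertex
  -- `s` and `u` is the last entry: the initial case `p = s` is covered by the length bound, and
  -- every later `p` differs from `s`.
  two-neighbours : ∀ {p u s} xs → Linked Adj (p ∷ xs ++ s ∷ []) → Unique (p ∷ xs) → All (_≢ s) xs →
    2 ≤ length xs ⊎ p ≢ s → u ∈ xs → ∃₂ λ a b → a ≢ b × Adj u a × Adj u b
  two-neighbours (u ∷ [])     (pu ∷ us ∷ _) _ _ (inj₁ (s≤s ())) (here refl)
  two-neighbours (u ∷ [])     (pu ∷ us ∷ _) _ _ (inj₂ p≢s)      (here refl) = _ , _ , p≢s , adj-sym pu , us
  two-neighbours (u ∷ y ∷ xs) (pu ∷ uy ∷ _) ((_ ∷ p≢y ∷ _) ∷ _) _ _ (here refl) = _ , _ , p≢y , adj-sym pu , uy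
  two-neighbours (x ∷ xs)     (_ ∷ l) (_ ∷ uniq) (x≢s ∷ xs≢s) _ (there u∈xs) =
      two-neighbours xs l uniq xs≢s (inj₂ x≢s) u∈xs

  private
    last-neighbour : ∀ {s} x xs → Linked Adj (x ∷ xs ++ s ∷ []) → ∃ λ y → y ∈ x ∷ xs × Adj y s
    last-neighbour x []       (xs ∷ _) = x , here refl , xs
    last-neighbour x (y ∷ xs) (_ ∷ l)  = let z , z∈ , zs = last-neighbour y xs l in z , there z∈ , zs

  -- Its use is that a leaf lies on no cycle. At the start vertex the two neighbours are the first
  -- and the last entry of `rest`.
  cycle-two-neighbours : (c : Cycle Adj) → ∀ {u} → u ∈ Cycle.start c ∷ Cycle.rest c →
    ∃₂ λ a b → a ≢ b × Adj u a × Adj u b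
  cycle-two-neighbours record
    { start = s ; rest = x ∷ y ∷ xs ; distinct = _ ∷ x≢ ∷ _ ; closed = sx ∷ _ ∷ l } (here refl) =
    let z , z∈ , zs = last-neighbour y xs l in x , z , All.lookup x≢ z∈ , sx , adj-sym zs
  cycle-two-neighbours record { rest = x ∷ [] ; long = s≤s () } (here refl)
  cycle-two-neighbours record { rest = rest ; long = long ; distinct = s≢ ∷ uniq ; closed = closed } (there u∈rest) =
    two-neighbours rest closed (s≢ ∷ uniq) (All.map (λ s≢x x≡s → s≢x (sym x≡s)) s≢) (inj₁ long) u∈rest

module LeafRemoval {V : Set} (_≟_ : DecidableEquality V) {Adj Adj′ : V → V → Set} (adj-sym : Symmetric Adj)
  {ℓ p : V} (leaf : ∀ q → Adj ℓ q → q ≡ p) (restrict : ∀ {x y} → Adj x y → x ≢ ℓ → y ≢ ℓ → Adj′ x y) where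

  -- A visit to the leaf enters from `p` and returns to `p`, so it is a detour that can be cut out.
  walk-avoiding : ∀ {x y} → Walk Adj x y → x ≢ ℓ → y ≢ ℓ → Walk Adj′ x y
  walk-avoiding-from : ∀ {x y z} → Adj x z → z ≡ ℓ → Walk Adj z y → x ≢ ℓ → y ≢ ℓ → Walk Adj′ x y
  walk-avoiding []                  x≢ℓ y≢ℓ = []
  walk-avoiding (_∷_ {y = z} a w)   x≢ℓ y≢ℓ with z ≟ ℓ
  ... | yes z≡ℓ = walk-avoiding-from a z≡ℓ w x≢ℓ y≢ℓ
  ... | no z≢ℓ  = restrict a x≢ℓ z≢ℓ ∷ walk-avoiding w z≢ℓ y≢ℓ
  walk-avoiding-from a z≡ℓ [] x≢ℓ y≢ℓ = ⊥-elim (y≢ℓ z≡ℓ)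
  walk-avoiding-from a refl (b ∷ w) x≢ℓ y≢ℓ with leaf _ (adj-sym a) | leaf _ b
  ... | refl | refl = walk-avoiding w x≢ℓ y≢ℓ

  -- All neighbours of `ℓ` coincide, so no cycle meets `ℓ` and every cycle survives the restriction
  -- to `Adj′`.
  acyclic-with-leaf : Acyclic Adj′ → Acyclic Adj
  acyclic-with-leaf acyclic′ c = acyclic′ record
    { start = start ; rest = rest ; long = long ; distinct = distinct
    ; closed = restrict-linked (All.++⁺ vertices≢ℓ (All.head vertices≢ℓ ∷ [])) closed }
    where
    open Cycle c
    vertices≢ℓ : All (_≢ ℓ) (start ∷ rest)
    vertices≢ℓ = All.tabulate λ { u∈ refl → let _ , _ , a≢b , ℓa , ℓb = cycle-two-neighbours adj-sym c u∈ in
      a≢b (trans (leaf _ ℓa) (sym (leaf _ ℓb))) }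
    restrict-linked : ∀ {xs} → All (_≢ ℓ) xs → Linked Adj xs → Linked Adj′ xs
    restrict-linked _ [] = []
    restrict-linked _ [-] = [-]
    restrict-linked (x≢ℓ ∷ y≢ℓ ∷ xs≢ℓ) (a ∷ l) = restrict a x≢ℓ y≢ℓ ∷ restrict-linked (y≢ℓ ∷ xs≢ℓ) l

module _ {V : Set} (_≟_ : DecidableEquality V) {Adj : V → V → Set}
  (adj-sym : Symmetric Adj) (adj-irrefl : ∀ {x} → ¬ Adj x x)
  (size : ℕ) (bounded : ∀ xs → Unique {A = V} xs → length xs ≤ size) where

  open DecMembership _≟_ using (_∈?_)

  private
    -- A neighbour `q` of `x` further along the path closes a cycle with the segment from `x` to
    -- `q`, whose interior is `as`. The last component reports the degenerate case, in which `q`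
    -- directly follows `x`.
    upTo : ∀ {x q} ys → Linked Adj (x ∷ ys) → Unique (x ∷ ys) → x ≢ q → q ∈ ys →
      ∃ λ as → Linked Adj (x ∷ as ++ q ∷ []) × Unique (q ∷ x ∷ as) × (∀ {z} → z ∈ as → z ∈ ys) ×
        (as ≡ [] → ∃ λ zs → ys ≡ q ∷ zs)
    upTo (q ∷ zs) (xq ∷ l) uniq x≢q (here refl) =
      [] , (xq ∷ [-]) , (((λ q≡x → x≢q (sym q≡x)) ∷ []) ∷ [] ∷ []) , (λ ()) , λ _ → zs , refl
    upTo {x} {q} (y ∷ ys) (xy ∷ l) ((x≢y ∷ x≢ys) ∷ y≢ys ∷ uniq) x≢q (there q∈ys)
      with upTo ys l (y≢ys ∷ uniq) (All.lookup y≢ys q∈ys) q∈ys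
    ... | as , l′ , ((q≢y ∷ q≢as) ∷ y≢as ∷ uniq′) , as⊆ys , _ =
      y ∷ as , (xy ∷ l′)
      , (((λ q≡x → x≢q (sym q≡x)) ∷ q≢y ∷ q≢as) ∷ (x≢y ∷ All.tabulate (All.lookup x≢ys ∘ as⊆ys)) ∷ y≢as ∷ uniq′)
      , (λ { (here eq) → here eq ; (there z∈) → there (as⊆ys z∈) }) , λ ()

  module _ (acyclic : Acyclic Adj)
    (branch : ∀ x y → Adj x y → (∃ λ z → z ≢ y × Adj x z) ⊎ (∀ z → Adj x z → z ≡ y)) where

    private
      -- Prolong a path at its head until it gets stuck; a neighbour already on the path would close a cycle.
      prolong : ∀ k x y ys → Linked Adj (x ∷ y ∷ ys) → Unique (x ∷ y ∷ ys) → size < k + length (x ∷ y ∷ ys) →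
        ∃₂ λ ℓ p → Adj ℓ p × (∀ q → Adj ℓ q → q ≡ p)
      prolong zero x y ys l uniq lt = contradiction (bounded _ uniq) (<⇒≱ lt)
      prolong (suc k) x y ys l@(xy ∷ _) uniq lt with branch x y xy
      ... | inj₂ leaf = x , y , xy , leaf
      ... | inj₁ (z , z≢y , xz) with z ∈? (x ∷ y ∷ ys)
      ...   | no z∉ = prolong k z x (y ∷ ys) (adj-sym xz ∷ l) (All.¬Any⇒All¬ _ z∉ ∷ uniq)
          (subst (size <_) (sym (+-suc k _)) lt)
      ...   | yes (here refl) = ⊥-elim (adj-irrefl xz)
      ...   | yes (there z∈) with upTo (y ∷ ys) l uniq (λ { refl → adj-irrefl xz }) z∈
      ...     | [] , _ , _ , _ , nil with nil refl
      ...       | _ , refl = ⊥-elim (z≢y refl)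
      prolong (suc k) x y ys l uniq lt | inj₁ (z , z≢y , xz) | yes (there z∈) | a ∷ as , l′ , uniq′ , _ =
        ⊥-elim (acyclic record
          { start = z ; rest = x ∷ a ∷ as ; long = s≤s (s≤s z≤n) ; distinct = uniq′ ; closed = adj-sym xz ∷ l′ })

    -- The starting path has two vertices, and `size` prolongations would make it longer than any
    -- list without repetition, so this fuel cannot run out.
    leaf-exists : ∀ {x y} → Adj x y → ∃₂ λ ℓ p → Adj ℓ p × (∀ q → Adj ℓ q → q ≡ p)
    leaf-exists {x} {y} xy =
        prolong size x y [] (xy ∷ [-]) (((λ { refl → adj-irrefl xy }) ∷ []) ∷ [] ∷ [])
        (subst (size <_) (+-comm 2 size) (s≤s (m≤n+m size 1)))

unique-lookup-injective : ∀ {V : Set} {xs : List V} → Unique xs → ∀ i j → List.lookup xs i ≡ List.lookup xs j → i ≡ j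
unique-lookup-injective (x≢ ∷ uniq) zero    zero    _  = refl
unique-lookup-injective (x≢ ∷ uniq) zero    (suc j) eq = ⊥-elim (All.lookup x≢ (∈-lookup j) eq)
unique-lookup-injective (x≢ ∷ uniq) (suc i) zero    eq = ⊥-elim (All.lookup x≢ (∈-lookup i) (sym eq))
unique-lookup-injective (x≢ ∷ uniq) (suc i) (suc j) eq = cong suc (unique-lookup-injective uniq i j eq)

unique-bounded : ∀ {V : Set} {k} (f : V → Fin k) → (∀ {x y} → f x ≡ f y → x ≡ y) → ∀ xs → Unique xs → length xs ≤ k
unique-bounded f f-inj xs uniq = injective⇒≤ {f = f ∘ List.lookup xs} (unique-lookup-injective uniq _ _ ∘ f-inj)

-- Raw data, degrees, and trees on the vertices of positive degree

Raw : ℕ → ℕ → Set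
Raw = RawPlaneBipartite

lookup-ext : ∀ {A : Set} {n} {xs ys : Vec A n} → (∀ i → lookup xs i ≡ lookup ys i) → xs ≡ ys
lookup-ext {xs = xs} {ys} eq = trans (sym (tabulate∘lookup xs)) (trans (tabulate-cong eq) (tabulate∘lookup ys))

lookup₂-ext : ∀ {A : Set} {n m} {M N : Vec (Vec A m) n} → (∀ i j → lookup (lookup M i) j ≡ lookup (lookup N i) j) →
    M ≡ N
lookup₂-ext eq = lookup-ext (lookup-ext ∘ eq)

entry : ∀ {n m} → Raw n m → Fin n → Fin m → Bool
entry r i j = lookup (lookup (adj r) i) j

nextW : ∀ {n m} → Raw n m → Fin n → Fin m → Fin m
nextW r i j = lookup (lookup (rotW r) i) j

nextB : ∀ {n m} → Raw n m → Fin m → Fin n → Fin n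
nextB r j i = lookup (lookup (rotB r) j) i

raw-ext : ∀ {n m} {r s : Raw n m} → (∀ i j → entry r i j ≡ entry s i j) → (∀ i j → nextW r i j ≡ nextW s i j) →
  (∀ j i → nextB r j i ≡ nextB s j i) → r ≡ s
raw-ext p q u = mkRaw-cong (lookup₂-ext p) (lookup₂-ext q) (lookup₂-ext u)
  where
  mkRaw-cong : ∀ {a a′ w w′ b b′} → a ≡ a′ → w ≡ w′ → b ≡ b′ → mkRaw a w b ≡ mkRaw a′ w′ b′
  mkRaw-cong refl refl refl = refl

raw-≟ : ∀ {n m} → DecidableEquality (Raw n m)
raw-≟ (mkRaw a w b) (mkRaw a′ w′ b′) =
  map′ (λ { (refl , refl , refl) → refl }) (λ { refl → refl , refl , refl })
    (Vec-≡-dec (Vec-≡-dec Bool._≟_) a a′ ×-dec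
        (Vec-≡-dec (Vec-≡-dec _≟ᶠ_) w w′ ×-dec Vec-≡-dec (Vec-≡-dec _≟ᶠ_) b b′))

degreeW : ∀ {n m} → Raw n m → Fin n → ℕ
degreeW r i = count (entry r i)

degreeB : ∀ {n m} → Raw n m → Fin m → ℕ
degreeB r j = count (λ i → entry r i j)

edge? : ∀ {n m} (r : Raw n m) i j → Dec (Edge r i j)
edge? r i j = T? (entry r i j)

adj-sym : ∀ {n m} (r : Raw n m) → Symmetric (Adj r)
adj-sym r {inj₁ i} {inj₂ j} ij = ij
adj-sym r {inj₂ j} {inj₁ i} ij = ij

-- Vertices of degree 0 count as absent: connectivity is only required between active vertices.
Active : ∀ {n m} → Raw n m → Fin n ⊎ Fin m → Set
Active r x = ∃ λ y → Adj r x y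

record SupportTree {n m} (r : Raw n m) : Set where
  constructor supportTree
  field
    connected : ∀ {x y} → Active r x → Active r y → Walk (Adj r) x y
    acyclic   : Acyclic (Adj r)

-- The cyclic conditions also apply to absent vertices, where the empty set of neighbours forces the
-- identity; these vertices therefore add no choices.
record PlaneTree {n m} (d : Fin n → ℕ) (e : Fin m → ℕ) (r : Raw n m) : Set where
  field
    isTree   : SupportTree r
    cyclicW  : ∀ i → IsCyclicOrderOn (Edge r i) (nextW r i)
    cyclicB  : ∀ j → IsCyclicOrderOn (λ i → Edge r i j) (nextB r j)
    degreeW≡ : ∀ i → degreeW r i ≡ d i
    degreeB≡ : ∀ j → degreeB r j ≡ e j
open PlaneTree

PlaneTrees : ∀ {n m} → (Fin n → ℕ) → (Fin m → ℕ) → Set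
PlaneTrees d e = Refinement (Raw _ _) (PlaneTree d e)

-- Exchange of colours

swap : ∀ {n m} → Raw n m → Raw m n
swap r = mkRaw (tabulate λ j → tabulate λ i → entry r i j) (rotB r) (rotW r)

entry-swap : ∀ {n m} (r : Raw n m) i j → entry (swap r) j i ≡ entry r i j
entry-swap r i j = trans (cong (λ row → lookup row i) (lookup∘tabulate _ j)) (lookup∘tabulate _ i)

swap-involution : ∀ {n m} (r : Raw n m) → swap (swap r) ≡ r
swap-involution r = raw-ext (λ i j → trans (entry-swap (swap r) j i) (entry-swap r i j)) (λ _ _ → refl) (λ _ _ → refl)

degreeW-swap : ∀ {n m} (r : Raw n m) j → degreeW (swap r) j ≡ degreeB r j
degreeW-swap r j = sum-cong-≗ λ i → cong toℕᵇ (entry-swap r i j)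

degreeB-swap : ∀ {n m} (r : Raw n m) i → degreeB (swap r) i ≡ degreeW r i
degreeB-swap r i = sum-cong-≗ λ j → cong toℕᵇ (entry-swap r i j)

module _ {n m} (r : Raw n m) where

  edge-swap : ∀ {i j} → Edge r i j → Edge (swap r) j i
  edge-swap = subst T (sym (entry-swap r _ _))

  edge-unswap : ∀ {i j} → Edge (swap r) j i → Edge r i j
  edge-unswap = subst T (entry-swap r _ _)

  adj-swap : ∀ x y → Adj r x y → Adj (swap r) (Sum.swap x) (Sum.swap y)
  adj-swap (inj₁ i) (inj₂ j) = edge-swap
  adj-swap (inj₂ j) (inj₁ i) = edge-swap

  adj-unswap : ∀ x y → Adj (swap r) x y → Adj r (Sum.swap x) (Sum.swap y)
  adj-unswap (inj₁ i) (inj₂ j) = edge-unswap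
  adj-unswap (inj₂ j) (inj₁ i) = edge-unswap

  supportTree-swap : SupportTree r → SupportTree (swap r)
  supportTree-swap (supportTree conn acyc) = supportTree
    (λ {x} {y} (x′ , xx′) (y′ , yy′) → subst₂ (Walk _) (swap-involutive x) (swap-involutive y)
      (walk-map Sum.swap adj-swap (conn (_ , adj-unswap x x′ xx′) (_ , adj-unswap y y′ yy′))))
    (acyclic-reflect Sum.swap adj-unswap
      (λ {x} {y} eq → trans (sym (swap-involutive x)) (trans (cong Sum.swap eq) (swap-involutive y))) acyc)

  planeTree-swap : ∀ {d e} → PlaneTree d e r → PlaneTree e d (swap r)
  planeTree-swap t = record
    { isTree   = supportTree-swap (isTree t)
    ; cyclicW  = λ j → cyclic-resp (λ i → edge-swap {i} {j}) (λ i → edge-unswap {i} {j}) (λ _ → refl) (cyclicB t j)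
    ; cyclicB  = λ i → cyclic-resp (λ j → edge-swap {i} {j}) (λ j → edge-unswap {i} {j}) (λ _ → refl) (cyclicW t i)
    ; degreeW≡ = λ j → trans (degreeW-swap r j) (degreeB≡ t j)
    ; degreeB≡ = λ i → trans (degreeB-swap r i) (degreeW≡ t i)
    }

planeTrees-swap : ∀ {n m} {d : Fin n → ℕ} {e : Fin m → ℕ} → PlaneTrees d e ↔ PlaneTrees e d
planeTrees-swap = refinement-↔ raw-≟ raw-≟ swap swap (λ r → planeTree-swap r) (λ r → planeTree-swap r)
  (λ r _ → swap-involution r) (λ r _ → swap-involution r)

-- Attaching and removing a white leaf

-- One relation serves both directions: `r′` is either what remains after the removal of the leaf or
-- the tree into which it is inserted. It speaks of adjacency only; rotations are treated
-- separately.
record Attached {n m} (r r′ : Raw n m) (i : Fin n) (j : Fin m) : Set where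
  field
    new  : Edge r i j
    old  : ∀ y → ¬ Edge r′ i y
    same : ∀ x y → x ≢ i → entry r x y ≡ entry r′ x y
    leaf : ∀ y → Edge r i y → y ≡ j

module _ {n m} {r r′ : Raw n m} {i : Fin n} {j : Fin m} (att : Attached r r′ i j) where
  open Attached att

  attached-degreeW : degreeW r i ≡ suc (degreeW r′ i)
  attached-degreeW = count-bump j new (old j) λ y y≢j →
    trans (¬T⇒≡false (y≢j ∘ leaf y)) (sym (¬T⇒≡false (old y)))

  attached-degreeW-other : ∀ x → x ≢ i → degreeW r x ≡ degreeW r′ x
  attached-degreeW-other x x≢i = sum-cong-≗ λ y → cong toℕᵇ (same x y x≢i)

  attached-degreeB : degreeB r j ≡ suc (degreeB r′ j)
  attached-degreeB = count-bump i new (old j) λ x x≢i → same x j x≢i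

  attached-entry-other : ∀ x y → y ≢ j → entry r x y ≡ entry r′ x y
  attached-entry-other x y y≢j with x ≟ᶠ i
  ... | yes refl = trans (¬T⇒≡false (y≢j ∘ leaf y)) (sym (¬T⇒≡false (old y)))
  ... | no x≢i   = same x y x≢i

  attached-degreeB-other : ∀ y → y ≢ j → degreeB r y ≡ degreeB r′ y
  attached-degreeB-other y y≢j = sum-cong-≗ λ x → cong toℕᵇ (attached-entry-other x y y≢j)

  attached-restrict : ∀ {x y} → Adj r x y → x ≢ inj₁ i → y ≢ inj₁ i → Adj r′ x y
  attached-restrict {inj₁ x} {inj₂ y} xy x≢i _ = subst T (same x y (x≢i ∘ cong inj₁)) xy
  attached-restrict {inj₂ y} {inj₁ x} xy _ x≢i = subst T (same x y (x≢i ∘ cong inj₁)) xy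

  attached-edge-extend : ∀ {x y} → Edge r′ x y → Edge r x y
  attached-edge-extend {x} {y} xy = subst T (sym (same x y λ { refl → old y xy })) xy

  attached-extend : ∀ x y → Adj r′ x y → Adj r x y
  attached-extend (inj₁ x) (inj₂ y) = attached-edge-extend
  attached-extend (inj₂ y) (inj₁ x) = attached-edge-extend

  private
    adj-leaf : ∀ q → Adj r (inj₁ i) q → q ≡ inj₂ j
    adj-leaf (inj₂ y) iy = cong inj₂ (leaf y iy)

    inactive : ∀ x → Active r′ x → x ≢ inj₁ i
    inactive _ (inj₂ y , iy) refl = old y iy

    module Removal = LeafRemoval (⊎-≡-dec _≟ᶠ_ _≟ᶠ_) {Adj r} {Adj r′} (λ {x} {y} → adj-sym r {x} {y}) adj-leaf
      (λ {x} {y} → attached-restrict {x} {y})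

  supportTree-remove : SupportTree r → SupportTree r′
  supportTree-remove (supportTree conn acyc) = supportTree
    (λ {x} {y} ax@(x′ , xx′) ay@(y′ , yy′) →
      Removal.walk-avoiding (conn (x′ , attached-extend x x′ xx′) (y′ , attached-extend y y′ yy′)) (inactive x ax)
          (inactive y ay))
    (acyclic-reflect id attached-extend id acyc)

  -- That `j` is active in `r′` ties the new edge to the old tree; walks to and from the leaf pass
  -- through `j`.
  supportTree-attach : Active r′ (inj₂ j) → SupportTree r′ → SupportTree r
  supportTree-attach act (supportTree conn acyc) = supportTree conn′ (Removal.acyclic-with-leaf acyc)
    where
    activate : ∀ x → x ≢ inj₁ i → Active r x → Active r′ x
    activate x x≢i (y , xy) with ⊎-≡-dec _≟ᶠ_ _≟ᶠ_ y (inj₁ i)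
    ... | no y≢i = y , attached-restrict {x} {y} xy x≢i y≢i
    -- A vertex whose given neighbour is the leaf can only be `j`.
    ... | yes refl with adj-leaf x (adj-sym r {x} {inj₁ i} xy)
    ...   | refl = act
    walk : ∀ {x y} → Active r′ x → Active r′ y → Walk (Adj r) x y
    walk ax ay = walk-map id attached-extend (conn ax ay)
    walk-snoc : ∀ {x y z} → Walk (Adj r) x y → Adj r y z → Walk (Adj r) x z
    walk-snoc []      b = b ∷ []
    walk-snoc (a ∷ w) b = a ∷ walk-snoc w b
    conn′ : ∀ {x y} → Active r x → Active r y → Walk (Adj r) x y
    conn′ {x} {y} ax ay with ⊎-≡-dec _≟ᶠ_ _≟ᶠ_ x (inj₁ i) | ⊎-≡-dec _≟ᶠ_ _≟ᶠ_ y (inj₁ i)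
    ... | yes refl | yes refl = []
    ... | yes refl | no y≢i   = _∷_ {y = inj₂ j} new (walk act (activate y y≢i ay))
    ... | no x≢i   | yes refl = walk-snoc {y = inj₂ j} (walk (activate x x≢i ax) act) new
    ... | no x≢i   | no y≢i   = walk (activate x x≢i ax) (activate y y≢i ay)

setEntry : ∀ {n m} → Fin n → Fin m → Bool → Vec (Vec Bool m) n → Vec (Vec Bool m) n
setEntry i j b M = updateAt M i (_[ j ]≔ b)

module _ {n m} (M : Vec (Vec Bool m) n) (i : Fin n) (j : Fin m) {b : Bool} where

  setEntry-self : lookup (lookup (setEntry i j b M) i) j ≡ b
  setEntry-self = trans (cong (λ row → lookup row j) (lookup∘updateAt i M)) (lookup∘updateAt j (lookup M i))

  setEntry-otherW : ∀ x y → x ≢ i → lookup (lookup (setEntry i j b M) x) y ≡ lookup (lookup M x) y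
  setEntry-otherW x y x≢i = cong (λ row → lookup row y) (lookup∘updateAt′ x i x≢i M)

  setEntry-otherB : ∀ x y → y ≢ j → lookup (lookup (setEntry i j b M) x) y ≡ lookup (lookup M x) y
  setEntry-otherB x y y≢j with x ≟ᶠ i
  ... | yes refl = trans (cong (λ row → lookup row y) (lookup∘updateAt i M)) (lookup∘updateAt′ y j y≢j (lookup M i))
  ... | no x≢i   = setEntry-otherW x y x≢i

-- On trees `rotW` can be kept: the rotation at the leaf is the identity both with its one neighbour
-- and with none.
remove : ∀ {n m} → Fin n → Fin m → Raw n m → Raw n m
remove i j r = mkRaw (setEntry i j false (adj r)) (rotW r) (updateAt (rotB r) j (tabulate ∘ spliceOut i ∘ lookup))

insert : ∀ {n m} → Fin n → Fin m → Fin n → Raw n m → Raw n m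
insert i j z r = mkRaw (setEntry i j true (adj r)) (rotW r) (updateAt (rotB r) j (tabulate ∘ spliceIn i z ∘ lookup))

module _ {n m} (r : Raw n m) (i : Fin n) (j : Fin m) where

  nextB-remove : ∀ x → nextB (remove i j r) j x ≡ spliceOut i (nextB r j) x
  nextB-remove x = trans (cong (λ v → lookup v x) (lookup∘updateAt j (rotB r))) (lookup∘tabulate _ x)

  nextB-remove-other : ∀ y x → y ≢ j → nextB (remove i j r) y x ≡ nextB r y x
  nextB-remove-other y x y≢j = cong (λ v → lookup v x) (lookup∘updateAt′ y j y≢j (rotB r))

  nextB-insert : ∀ z x → nextB (insert i j z r) j x ≡ spliceIn i z (nextB r j) x
  nextB-insert z x = trans (cong (λ v → lookup v x) (lookup∘updateAt j (rotB r))) (lookup∘tabulate _ x)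

  nextB-insert-other : ∀ z y x → y ≢ j → nextB (insert i j z r) y x ≡ nextB r y x
  nextB-insert-other z y x y≢j = cong (λ v → lookup v x) (lookup∘updateAt′ y j y≢j (rotB r))

  attached-remove : Edge r i j → (∀ y → Edge r i y → y ≡ j) → Attached r (remove i j r) i j
  attached-remove ij leaf = record
    { new  = ij
    ; old  = none
    ; same = λ x y x≢i → sym (setEntry-otherW (adj r) i j x y x≢i)
    ; leaf = leaf
    }
    where
    none : ∀ y → ¬ Edge (remove i j r) i y
    none y iy with y ≟ᶠ j
    ... | yes refl = subst T (setEntry-self (adj r) i j) iy
    ... | no y≢j   = y≢j (leaf y (subst T (setEntry-otherB (adj r) i j i y y≢j) iy))

  attached-insert : ∀ z → (∀ y → ¬ Edge r i y) → Attached (insert i j z r) r i j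
  attached-insert z none = record
    { new  = subst T (sym (setEntry-self (adj r) i j)) _
    ; old  = none
    ; same = λ x y x≢i → setEntry-otherW (adj r) i j x y x≢i
    ; leaf = leaf′
    }
    where
    leaf′ : ∀ y → Edge (insert i j z r) i y → y ≡ j
    leaf′ y iy with y ≟ᶠ j
    ... | yes y≡j = y≡j
    ... | no y≢j  = ⊥-elim (none y (subst T (setEntry-otherB (adj r) i j i y y≢j) iy))

remove-insert : ∀ {n m} (r : Raw n m) i j z → (∀ y → ¬ Edge r i y) →
  (∀ x → spliceOut i (spliceIn i z (nextB r j)) x ≡ nextB r j x) → remove i j (insert i j z r) ≡ r
remove-insert r i j z none splice = raw-ext entry≡ (λ _ _ → refl) nextB≡
  where
  r⁺ = insert i j z r
  entry≡ : ∀ x y → entry (remove i j r⁺) x y ≡ entry r x y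
  entry≡ x y with x ≟ᶠ i | y ≟ᶠ j
  ... | yes refl | yes refl = trans (setEntry-self (adj r⁺) i j) (sym (¬T⇒≡false (none j)))
  ... | no x≢i   | _        = trans (setEntry-otherW (adj r⁺) i j x y x≢i) (setEntry-otherW (adj r) i j x y x≢i)
  ... | yes _    | no y≢j   = trans (setEntry-otherB (adj r⁺) i j x y y≢j) (setEntry-otherB (adj r) i j x y y≢j)
  nextB≡ : ∀ y x → nextB (remove i j r⁺) y x ≡ nextB r y x
  nextB≡ y x with y ≟ᶠ j
  ... | yes refl = trans (nextB-remove r⁺ i j x) (trans (spliceOut-cong (nextB-insert r i j z) x) (splice x))
  ... | no y≢j   = trans (nextB-remove-other r⁺ i j y x y≢j) (nextB-insert-other r i j z y x y≢j)

insert-remove : ∀ {n m} (r : Raw n m) i j → Edge r i j →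
  (∀ x → spliceIn i (nextB r j i) (spliceOut i (nextB r j)) x ≡ nextB r j x) →
      insert i j (nextB r j i) (remove i j r) ≡ r
insert-remove r i j ij splice = raw-ext entry≡ (λ _ _ → refl) nextB≡
  where
  r⁻ = remove i j r
  entry≡ : ∀ x y → entry (insert i j (nextB r j i) r⁻) x y ≡ entry r x y
  entry≡ x y with x ≟ᶠ i | y ≟ᶠ j
  ... | yes refl | yes refl = trans (setEntry-self (adj r⁻) i j) (sym (T⇒≡true ij))
  ... | no x≢i   | _        = trans (setEntry-otherW (adj r⁻) i j x y x≢i) (setEntry-otherW (adj r) i j x y x≢i)
  ... | yes _    | no y≢j   = trans (setEntry-otherB (adj r⁻) i j x y y≢j) (setEntry-otherB (adj r) i j x y y≢j)
  nextB≡ : ∀ y x → nextB (insert i j (nextB r j i) r⁻) y x ≡ nextB r y x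
  nextB≡ y x with y ≟ᶠ j
  ... | yes refl = trans (nextB-insert r⁻ i j (nextB r j i) x)
      (trans (spliceIn-cong (nextB-remove r i j) x) (splice x))
  ... | no y≢j   = trans (nextB-insert-other r⁻ i j _ y x y≢j) (nextB-remove-other r i j y x y≢j)

-- Leaf removal as a bijection between trees with prescribed degrees

lower : ∀ {n} → (Fin n → ℕ) → Fin n → Fin n → ℕ
lower d i = updateAtᶠ d i pred

lower-self : ∀ {n} (d : Fin n → ℕ) i {k} → d i ≡ k → lower d i i ≡ pred k
lower-self d i eq = trans (updateAtᶠ-updates i d) (cong pred eq)

lower-other : ∀ {n} (d : Fin n → ℕ) i x → x ≢ i → lower d i x ≡ d x
lower-other d i x x≢i = updateAtᶠ-minimal x i d x≢i

module _ {n} {f g d : Fin n → ℕ} (i : Fin n) (bump : f i ≡ suc (g i)) (other : ∀ x → x ≢ i → f x ≡ g x) where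

  bump⇒lower : f ≗ d → g ≗ lower d i
  bump⇒lower f≗d x with x ≟ᶠ i
  ... | yes refl = sym (lower-self d i (trans (sym (f≗d i)) bump))
  ... | no x≢i   = trans (sym (other x x≢i)) (trans (f≗d x) (sym (lower-other d i x x≢i)))

  -- As `pred` fixes 0, `d i` can be recovered from the lowered value only when it is not 0.
  lower⇒bump : d i ≢ 0 → g ≗ lower d i → f ≗ d
  lower⇒bump di≢0 g≗ x with x ≟ᶠ i
  ... | yes refl = trans bump
      (trans (cong suc (trans (g≗ i) (lower-self d i refl))) (suc-pred (d i) {{≢-nonZero di≢0}}))
  ... | no x≢i   = trans (other x x≢i) (trans (g≗ x) (lower-other d i x x≢i))

module _ {n m} {d : Fin n → ℕ} {e : Fin m → ℕ} {i : Fin n} {j : Fin m} (di≡1 : d i ≡ 1) where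

  module _ {r : Raw n m} (t : PlaneTree d e r) (ij : Edge r i j) (ej≢1 : e j ≢ 1) where

    private
      edgeB? = λ x → edge? r x j
      att : Attached r (remove i j r) i j
      att = attached-remove r i j ij (count≡1⇒unique (entry r i) j (trans (degreeW≡ t i) di≡1) ij)
      open Attached att

    -- Since `j` has a second neighbour, its rotation cannot fix `i`.
    next≢leaf : nextB r j i ≢ i
    next≢leaf =
      let z , z≢i , zj = count≢1⇒another (λ x → entry r x j) i (ej≢1 ∘ trans (sym (degreeB≡ t j))) ij in
      cyclic-moves edgeB? (cyclicB t j) ij zj z≢i

    next-edge : Edge (remove i j r) (nextB r j i) j
    next-edge = subst T (same _ j next≢leaf) (proj₁ (proj₂ (cyclicB t j)) i ij)

    planeTree-remove : PlaneTree (lower d i) (lower e j) (remove i j r)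
    planeTree-remove = record
      { isTree   = supportTree-remove att (isTree t)
      ; cyclicW  = cyclicW′
      ; cyclicB  = cyclicB′
      ; degreeW≡ = bump⇒lower i (attached-degreeW att) (attached-degreeW-other att) (degreeW≡ t)
      ; degreeB≡ = bump⇒lower j (attached-degreeB att) (attached-degreeB-other att) (degreeB≡ t)
      }
      where
      cyclicW′ : ∀ x → IsCyclicOrderOn (Edge (remove i j r) x) (nextW r x)
      cyclicW′ x with x ≟ᶠ i
      ... | no x≢i   = cyclic-resp (λ y → subst T (same x y x≢i)) (λ y → subst T (sym (same x y x≢i)))
                                   (λ _ → refl) (cyclicW t x)
      ... | yes refl = cyclic-id (cyclic-singleton (edge? r i) (cyclicW t i) λ y y′ iy iy′ →
          trans (leaf y iy) (sym (leaf y′ iy′)))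
                                 (λ y _ iy _ → ⊥-elim (old y iy))
      cyclicB′ : ∀ y → IsCyclicOrderOn (λ x → Edge (remove i j r) x y) (nextB (remove i j r) y)
      cyclicB′ y with y ≟ᶠ j
      ... | no y≢j   = cyclic-resp (λ x → subst T (attached-entry-other att x y y≢j))
                                   (λ x → subst T (sym (attached-entry-other att x y y≢j)))
                                   (λ x → sym (nextB-remove-other r i j y x y≢j)) (cyclicB t y)
      ... | yes refl = cyclic-resp (λ x (xj , x≢i) → subst T (same x j x≢i) xj)
                                   (λ x xj → attached-edge-extend att {x} xj , λ { refl → old j xj })
                                   (λ x → sym (nextB-remove r i j x))
                                   (spliceOut-cyclic edgeB? (cyclicB t j) ij next≢leaf)

    insert-remove-planeTree : insert i j (nextB r j i) (remove i j r) ≡ r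
    insert-remove-planeTree = insert-remove r i j ij (spliceIn∘spliceOut edgeB? (cyclicB t j))

  module _ {r : Raw n m} (t : PlaneTree (lower d i) (lower e j) r) {z : Fin n} (zj : Edge r z j) (ej≢0 : e j ≢ 0)
      where

    private
      edgeB? = λ x → edge? r x j
      none : ∀ y → ¬ Edge r i y
      none y iy = count≢0 (entry r i) y iy (trans (degreeW≡ t i) (lower-self d i di≡1))
      att : Attached (insert i j z r) r i j
      att = attached-insert r i j z none
      open Attached att

    planeTree-insert : PlaneTree d e (insert i j z r)
    planeTree-insert = record
      { isTree   = supportTree-attach att (inj₁ z , zj) (isTree t)
      ; cyclicW  = cyclicW′
      ; cyclicB  = cyclicB′
      ; degreeW≡ = lower⇒bump i (attached-degreeW att) (attached-degreeW-other att)
          (λ eq → 1+n≢0 (trans (sym di≡1) eq)) (degreeW≡ t)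
      ; degreeB≡ = lower⇒bump j (attached-degreeB att) (attached-degreeB-other att) ej≢0 (degreeB≡ t)
      }
      where
      cyclicW′ : ∀ x → IsCyclicOrderOn (Edge (insert i j z r) x) (nextW r x)
      cyclicW′ x with x ≟ᶠ i
      ... | no x≢i   = cyclic-resp (λ y → subst T (sym (same x y x≢i))) (λ y → subst T (same x y x≢i))
                                   (λ _ → refl) (cyclicW t x)
      ... | yes refl = cyclic-id (cyclic-singleton (edge? r i) (cyclicW t i) λ y _ iy _ → ⊥-elim (none y iy))
                                 (λ y y′ iy iy′ → trans (leaf y iy) (sym (leaf y′ iy′)))
      cyclicB′ : ∀ y → IsCyclicOrderOn (λ x → Edge (insert i j z r) x y) (nextB (insert i j z r) y)
      cyclicB′ y with y ≟ᶠ j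
      ... | no y≢j   = cyclic-resp (λ x → subst T (sym (attached-entry-other att x y y≢j)))
                                   (λ x → subst T (attached-entry-other att x y y≢j))
                                   (λ x → sym (nextB-insert-other r i j z y x y≢j)) (cyclicB t y)
      ... | yes refl = cyclic-resp (λ { x (inj₁ xj) → attached-edge-extend att {x} xj ; x (inj₂ refl) → new })
                                   (λ x xj → by-cases x xj (x ≟ᶠ i))
                                   (λ x → sym (nextB-insert r i j z x))
                                   (spliceIn-cyclic edgeB? (cyclicB t j) (none j) zj)
        where
        by-cases : ∀ x → Edge (insert i j z r) x j → Dec (x ≡ i) → Edge r x j ⊎ x ≡ i
        by-cases x xj (yes x≡i) = inj₂ x≡i
        by-cases x xj (no x≢i)  = inj₁ (subst T (same x j x≢i) xj)

    remove-insert-planeTree : remove i j (insert i j z r) ≡ r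
    remove-insert-planeTree = remove-insert r i j z none (spliceOut∘spliceIn edgeB? (cyclicB t j) (none j) zj)

  -- The map back reads the corner off the rotation, as the successor of `i` at `j`. With `e j` at
  -- least 2, this successor is still a neighbour of `j` after the removal.
  leaf-removal : ∀ {k} → e j ≡ suc (suc k) →
    (Σ (PlaneTrees (lower d i) (lower e j)) λ t → Σ (Fin n) λ z → Edge (value t) z j) ↔
    Refinement (Raw n m) λ r → PlaneTree d e r × Edge r i j
  leaf-removal ej≡ = mk↔ₛ′ to from
    (λ (r , [ tij ]) → refinement-≡ (recompute (raw-≟ _ _) (insert-remove-planeTree (proj₁ tij) (proj₂ tij) ej≢1)))
    (λ ((r , [ t ]) , z , zj) → triple-≡ (recompute (raw-≟ _ _) (remove-insert-planeTree t zj ej≢0))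
      (trans (nextB-insert r i j z i) spliceIn-self))
    where
    ej≢0 : e j ≢ 0
    ej≢0 eq = 1+n≢0 (trans (sym ej≡) eq)
    ej≢1 : e j ≢ 1
    ej≢1 eq = 1+n≢0 (suc-injective (trans (sym ej≡) eq))
    to : (Σ (PlaneTrees (lower d i) (lower e j)) λ t → Σ (Fin n) λ z → Edge (value t) z j) →
      Refinement (Raw n m) λ r → PlaneTree d e r × Edge r i j
    to ((r , [ t ]) , z , zj) =
      insert i j z r , [ planeTree-insert t zj ej≢0 , subst T (sym (setEntry-self (adj r) i j)) _ ]
    from : (Refinement (Raw n m) λ r → PlaneTree d e r × Edge r i j) →
      Σ (PlaneTrees (lower d i) (lower e j)) λ t → Σ (Fin n) λ z → Edge (value t) z j
    from (r , [ tij ]) = (remove i j r , [ planeTree-remove (proj₁ tij) (proj₂ tij) ej≢1 ]) , nextB r j i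
      , recompute (T? _) (next-edge (proj₁ tij) (proj₂ tij) ej≢1)
    triple-≡ : ∀ {d e} {t t′ : PlaneTrees d e} {z z′ : Fin n} {p : Edge (value t) z j} {p′ : Edge (value t′) z′ j} →
      value t ≡ value t′ → z ≡ z′ →
          _≡_ {A = Σ (PlaneTrees d e) λ t → Σ (Fin n) λ z → Edge (value t) z j} (t , z , p) (t′ , z′ , p′)
    triple-≡ {t = t@(_ , _)} {_ , _} {z} {p = p} {p′} refl refl = cong (λ q → t , z , q) (T-irrelevant p p′)

-- Isolated edges, and degree sequences after a removal

walk-invariant : ∀ {V : Set} {Adj : V → V → Set} (P : V → Set) → (∀ x y → P x → Adj x y → P y) →
  ∀ {x y} → Walk Adj x y → P x → P y
walk-invariant P inv []      px = px
walk-invariant P inv (a ∷ w) px = walk-invariant P inv w (inv _ _ px a)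

-- The pair `i`, `j` is closed under adjacency and walks from `i` reach every active vertex, so
-- nothing else is active.
isolated-edge : ∀ {n m} {r : Raw n m} {i j} → SupportTree r → Edge r i j → (∀ y → Edge r i y → y ≡ j) →
    (∀ x → Edge r x j → x ≡ i) →
  ∀ x y → Edge r x y → x ≡ i × y ≡ j
isolated-edge {n} {m} {r} {i} {j} (supportTree conn _) ij leafW leafB x y xy =
  x≡i , leafW y (subst (λ x → Edge r x y) x≡i xy)
  where
  End : Fin n ⊎ Fin m → Set
  End (inj₁ x) = x ≡ i
  End (inj₂ y) = y ≡ j
  end-step : ∀ u v → End u → Adj r u v → End v
  end-step (inj₁ _) (inj₂ y) refl iy = leafW y iy
  end-step (inj₂ _) (inj₁ x) refl xj = leafB x xj
  x≡i : x ≡ i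
  x≡i = walk-invariant End end-step (conn {inj₁ i} {inj₁ x} (inj₂ j , ij) (inj₂ y , xy)) refl

no-edge⇒count≡0 : ∀ {n} (p : Fin n → Bool) → (∀ x → ¬ T (p x)) → count p ≡ 0
no-edge⇒count≡0 p none = sum-zero λ x → cong toℕᵇ (¬T⇒≡false (none x))

sum-lower : ∀ {n} (d : Fin n → ℕ) i {k} → d i ≡ suc k → sum d ≡ suc (sum (lower d i))
sum-lower d i eq = sum-bump i (trans eq (cong suc (sym (lower-self d i eq)))) λ x x≢i → sym (lower-other d i x x≢i)

support-lower-1 : ∀ {n} (d : Fin n → ℕ) i → d i ≡ 1 → support d ≡ suc (support (lower d i))
support-lower-1 d i eq = sum-bump i (trans (cong positive eq) (cong (suc ∘ positive) (sym (lower-self d i eq))))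
  λ x x≢i → cong positive (sym (lower-other d i x x≢i))

support-lower-2 : ∀ {n} (d : Fin n → ℕ) i {k} → d i ≡ suc (suc k) → support d ≡ support (lower d i)
support-lower-2 d i eq = sum-cong-≗ same
  where
  same : ∀ x → positive (d x) ≡ positive (lower d i x)
  same x with x ≟ᶠ i
  ... | yes refl = trans (cong positive eq) (cong positive (sym (lower-self d i eq)))
  ... | no x≢i   = cong positive (sym (lower-other d i x x≢i))

support-all : ∀ {n} (d : Fin n → ℕ) → (∀ i → d i ≢ 0) → support d ≡ n
support-all {zero}  d d≢0 = refl
support-all {suc n} d d≢0 with d zero in eq
... | zero  = ⊥-elim (d≢0 zero eq)
... | suc _ = cong suc (support-all (d ∘ suc) (d≢0 ∘ suc))

support-another : ∀ {n} (d : Fin n → ℕ) i {k} → d i ≡ 1 → support d ≡ suc (suc k) → ∃ λ x → x ≢ i × d x ≢ 0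
support-another d i di≡1 eq with sum-witness (positive ∘ lower d i)
    (suc-injective (trans (sym (support-lower-1 d i di≡1)) eq))
... | x , pos≢0 = x , x≢i , λ dx≡0 → pos≢0 (cong positive (trans (lower-other d i x x≢i) dx≡0))
  where
  x≢i : x ≢ i
  x≢i refl = pos≢0 (cong positive (lower-self d i di≡1))

-- Degree sums of a plane tree

-- The degrees of either colour count each edge once, and a tree has one edge fewer than vertices.
DegreeSums : ∀ {n m} → Raw n m → Set
DegreeSums r = suc (sum (degreeW r)) ≡ support (degreeW r) + support (degreeB r)
             × suc (sum (degreeB r)) ≡ support (degreeW r) + support (degreeB r)

-- The induction measure, symmetric in the colours so that `swap` preserves it.
degreeTotal : ∀ {n m} → Raw n m → ℕ
degreeTotal r = sum (degreeW r) + sum (degreeB r)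

support-cong : ∀ {n} {d d′ : Fin n → ℕ} → d ≗ d′ → support d ≡ support d′
support-cong d≗d′ = sum-cong-≗ (cong positive ∘ d≗d′)

degreeSums-unswap : ∀ {n m} (r : Raw n m) → DegreeSums (swap r) → DegreeSums r
degreeSums-unswap r (eqW , eqB) =
    trans (cong suc (sym sumB)) (trans eqB vertices)
  , trans (cong suc (sym sumW)) (trans eqW vertices)
  where
  sumW = sum-cong-≗ (degreeW-swap r)
  sumB = sum-cong-≗ (degreeB-swap r)
  vertices = trans (cong₂ _+_ (support-cong (degreeW-swap r)) (support-cong (degreeB-swap r)))
      (+-comm (support (degreeB r)) _)

degreeTotal-swap : ∀ {n m} (r : Raw n m) → degreeTotal (swap r) ≡ degreeTotal r
degreeTotal-swap r = trans (cong₂ _+_ (sum-cong-≗ (degreeW-swap r)) (sum-cong-≗ (degreeB-swap r)))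
    (+-comm (sum (degreeB r)) _)

sum-indicator : ∀ {n} (d : Fin n → ℕ) i → d i ≡ 1 → (∀ x → x ≢ i → d x ≡ 0) → sum d ≡ 1
sum-indicator {n} d i di≡1 other = trans (sum-bump {g = const 0} i di≡1 other) (cong suc (sum-replicate-zero n))

-- If `j` has degree 1, the tree is a single edge: both sums are 1 and there are two vertices.
-- Otherwise removing the leaf lowers both sums and the number of vertices by one, and `j` keeps an
-- edge, which the induction hypothesis asks for.
degreeSums-whiteLeaf : ∀ {n m} (r : Raw n m) {i j} → SupportTree r → Edge r i j → (∀ y → Edge r i y → y ≡ j) →
  (∀ (r′ : Raw n m) {i j} → SupportTree r′ → Edge r′ i j → degreeTotal r′ < degreeTotal r → DegreeSums r′) →
  DegreeSums r
degreeSums-whiteLeaf r {i} {j} tree ij leaf ih with degreeB r j ≟ 1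
... | yes degB≡1 =
    trans (cong suc (sum-indicator _ i degW≡1 degW≡0)) vertices
  , trans (cong suc (sum-indicator _ j degB≡1 degB≡0)) vertices
  where
  only = isolated-edge tree ij leaf (count≡1⇒unique (λ x → entry r x j) i degB≡1 ij)
  degW≡1 = unique⇒count≡1 (entry r i) j ij leaf
  degW≡0 = λ x x≢i → no-edge⇒count≡0 (entry r x) λ y xy → x≢i (proj₁ (only x y xy))
  degB≡0 = λ y y≢j → no-edge⇒count≡0 (λ x → entry r x y) λ x xy → y≢j (proj₂ (only x y xy))
  vertices : 2 ≡ support (degreeW r) + support (degreeB r)
  vertices = sym (cong₂ _+_ (sum-indicator _ i (cong positive degW≡1) λ x x≢i → cong positive (degW≡0 x x≢i))
                            (sum-indicator _ j (cong positive degB≡1) λ y y≢j → cong positive (degB≡0 y y≢j)))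
... | no degB≢1 with count≢1⇒another (λ x → entry r x j) i degB≢1 ij
...   | z , z≢i , zj = combine
    (ih r′ (supportTree-remove att tree) zj′
    (subst₂ (λ a b → degreeTotal r′ < a + b) (sym sumW) (sym sumB) (+-mono-< (n<1+n _) (n<1+n _))))
  where
  r′ = remove i j r
  att = attached-remove r i j ij leaf
  zj′ : Edge r′ z j
  zj′ = subst T (Attached.same att z j z≢i) zj
  sumW : sum (degreeW r) ≡ suc (sum (degreeW r′))
  sumW = sum-bump i (attached-degreeW att) (attached-degreeW-other att)
  sumB : sum (degreeB r) ≡ suc (sum (degreeB r′))
  sumB = sum-bump j (attached-degreeB att) (attached-degreeB-other att)
  supportW : support (degreeW r) ≡ suc (support (degreeW r′))
  supportW = sum-bump i
    (trans (cong positive (attached-degreeW att))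
        (cong (suc ∘ positive) (sym (no-edge⇒count≡0 (entry r′ i) (Attached.old att)))))
    λ x x≢i → cong positive (attached-degreeW-other att x x≢i)
  positive≢0 : ∀ {k} → k ≢ 0 → positive k ≡ 1
  positive≢0 {zero}  ≢0 = ⊥-elim (≢0 refl)
  positive≢0 {suc _} _  = refl
  positiveB : ∀ y → positive (degreeB r y) ≡ positive (degreeB r′ y)
  positiveB y with y ≟ᶠ j
  ... | yes refl = trans (cong positive (attached-degreeB att))
      (sym (positive≢0 (count≢0 (λ x → entry r′ x j) z zj′)))
  ... | no y≢j   = cong positive (attached-degreeB-other att y y≢j)
  combine : DegreeSums r′ → DegreeSums r
  combine (eqW , eqB) =
      trans (cong suc sumW) (trans (cong suc eqW) vertices)
    , trans (cong suc sumB) (trans (cong suc eqB) vertices)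
    where vertices = cong₂ _+_ (sym supportW) (sym (sum-cong-≗ positiveB))

-- An edge is demanded because on an empty support the identities would read 1 = 0. It also starts
-- the search for a leaf; a black leaf is made white by exchanging the colours.
degree-sums : ∀ k {n m} (r : Raw n m) {i j} → degreeTotal r < k → SupportTree r → Edge r i j → DegreeSums r
degree-sums (suc k) {n} {m} r {i} {j} (s≤s lt) tree ij = by-leaf
  (leaf-exists (⊎-≡-dec _≟ᶠ_ _≟ᶠ_) {Adj r} (λ {x} {y} → adj-sym r {x} {y}) (λ {x} → adj-irrefl {x}) (n + m)
    (unique-bounded (join n m) λ {x} {y} eq →
        trans (sym (splitAt-join n m x)) (trans (cong (splitAt n) eq) (splitAt-join n m y)))
    (SupportTree.acyclic tree) branch {inj₁ i} {inj₂ j} ij)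
  where
  adj-irrefl : ∀ {x} → ¬ Adj r x x
  adj-irrefl {inj₁ _} ()
  adj-irrefl {inj₂ _} ()
  branch : ∀ x y → Adj r x y → (∃ λ z → z ≢ y × Adj r x z) ⊎ (∀ z → Adj r x z → z ≡ y)
  branch (inj₁ i) (inj₂ j) ij with degreeW r i ≟ 1
  ... | yes eq = inj₂ λ { (inj₂ y) iy → cong inj₂ (count≡1⇒unique (entry r i) j eq ij y iy) }
  ... | no neq = let y , y≢j , iy = count≢1⇒another (entry r i) j neq ij in inj₁ (inj₂ y , y≢j ∘ inj₂-injective , iy)
  branch (inj₂ j) (inj₁ i) ij with degreeB r j ≟ 1
  ... | yes eq = inj₂ λ { (inj₁ x) xj → cong inj₁ (count≡1⇒unique (λ x → entry r x j) i eq ij x xj) }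
  ... | no neq = let x , x≢i , xj = count≢1⇒another (λ x → entry r x j) i neq ij in
      inj₁ (inj₁ x , x≢i ∘ inj₁-injective , xj)
  by-leaf : (∃₂ λ ℓ p → Adj r ℓ p × (∀ q → Adj r ℓ q → q ≡ p)) → DegreeSums r
  by-leaf (inj₁ i , inj₂ j , ij , leaf) = degreeSums-whiteLeaf r tree ij (λ y iy → inj₂-injective (leaf (inj₂ y) iy))
    λ r′ tree′ ij′ lt′ → degree-sums k r′ (<-≤-trans lt′ lt) tree′ ij′
  by-leaf (inj₂ j , inj₁ i , ij , leaf) = degreeSums-unswap r
    (degreeSums-whiteLeaf (swap r) (supportTree-swap r tree) (edge-swap r ij)
      (λ x jx → inj₁-injective (leaf (inj₁ x) (edge-unswap r jx)))
      λ r′ tree′ ij′ lt′ → degree-sums k r′ (<-≤-trans lt′ (subst (_≤ k) (sym (degreeTotal-swap r)) lt)) tree′ ij′)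

-- The base case: a single edge

module SingleEdge {n m} {d : Fin n → ℕ} {e : Fin m → ℕ} {i : Fin n} {j : Fin m} (di≡1 : d i ≡ 1) (ej≡1 : e j ≡ 1)
  (d≡0 : ∀ x → x ≢ i → d x ≡ 0) (e≡0 : ∀ y → y ≢ j → e y ≡ 0) where

  private
    isEdge : ∀ x y → Dec (x ≡ i × y ≡ j)
    isEdge x y = x ≟ᶠ i ×-dec y ≟ᶠ j

    edgeTree : Raw n m
    edgeTree = mkRaw (tabulate λ x → tabulate λ y → ⌊ isEdge x y ⌋) (replicate n (allFin m)) (replicate m (allFin n))

    entry-edgeTree : ∀ x y → entry edgeTree x y ≡ ⌊ isEdge x y ⌋
    entry-edgeTree x y = trans (cong (λ row → lookup row y) (lookup∘tabulate _ x)) (lookup∘tabulate _ y)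

    edge⇒ : ∀ x y → Edge edgeTree x y → x ≡ i × y ≡ j
    edge⇒ x y xy = toWitness (subst T (entry-edgeTree x y) xy)

    ij : Edge edgeTree i j
    ij = subst T (sym (entry-edgeTree i j)) (fromWitness (refl , refl))

    nextW≡id : ∀ x → nextW edgeTree x ≗ id
    nextW≡id x y = trans (cong (λ v → lookup v y) (lookup-replicate x _)) (lookup-allFin y)

    nextB≡id : ∀ y → nextB edgeTree y ≗ id
    nextB≡id y x = trans (cong (λ v → lookup v x) (lookup-replicate y _)) (lookup-allFin x)

    neighbour-unique : ∀ {x y z} → Adj edgeTree x y → Adj edgeTree x z → y ≡ z
    neighbour-unique {inj₁ x} {inj₂ y} {inj₂ z} xy xz =
        cong inj₂ (trans (proj₂ (edge⇒ x y xy)) (sym (proj₂ (edge⇒ x z xz))))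
    neighbour-unique {inj₂ x} {inj₁ y} {inj₁ z} xy xz =
        cong inj₁ (trans (proj₁ (edge⇒ y x xy)) (sym (proj₁ (edge⇒ z x xz))))

    edgeTree-connected : ∀ {x y} → Active edgeTree x → Active edgeTree y → Walk (Adj edgeTree) x y
    edgeTree-connected {inj₁ x} {inj₁ y} (inj₂ x′ , xx′) (inj₂ y′ , yy′)
      with refl , _ ← edge⇒ x x′ xx′ | refl , _ ← edge⇒ y y′ yy′ = []
    edgeTree-connected {inj₂ x} {inj₂ y} (inj₁ x′ , xx′) (inj₁ y′ , yy′)
      with _ , refl ← edge⇒ x′ x xx′ | _ , refl ← edge⇒ y′ y yy′ = []
    edgeTree-connected {inj₁ x} {inj₂ y} (inj₂ x′ , xx′) (inj₁ y′ , yy′)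
      with refl , _ ← edge⇒ x x′ xx′ | _ , refl ← edge⇒ y′ y yy′ = ij ∷ []
    edgeTree-connected {inj₂ x} {inj₁ y} (inj₁ x′ , xx′) (inj₂ y′ , yy′)
      with _ , refl ← edge⇒ x′ x xx′ | refl , _ ← edge⇒ y y′ yy′ = ij ∷ []

    edgeTree-plane : PlaneTree d e edgeTree
    edgeTree-plane = record
      { isTree   = supportTree (λ {x} {y} → edgeTree-connected {x} {y}) λ c →
          let a , b , a≢b , sa , sb = cycle-two-neighbours (λ {x} {y} → adj-sym edgeTree {x} {y}) c (here refl) in
          a≢b (neighbour-unique {Cycle.start c} {a} {b} sa sb)
      ; cyclicW  = λ x → cyclic-id (nextW≡id x) λ y z xy xz →
          trans (proj₂ (edge⇒ x y xy)) (sym (proj₂ (edge⇒ x z xz)))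
      ; cyclicB  = λ y → cyclic-id (nextB≡id y) λ x z xy zy →
          trans (proj₁ (edge⇒ x y xy)) (sym (proj₁ (edge⇒ z y zy)))
      ; degreeW≡ = degW
      ; degreeB≡ = degB
      }
      where
      degW : ∀ x → degreeW edgeTree x ≡ d x
      degW x with x ≟ᶠ i
      ... | yes refl = trans (unique⇒count≡1 (entry edgeTree i) j ij λ y iy → proj₂ (edge⇒ i y iy)) (sym di≡1)
      ... | no x≢i   = trans (no-edge⇒count≡0 (entry edgeTree x) λ y xy → x≢i (proj₁ (edge⇒ x y xy)))
          (sym (d≡0 x x≢i))
      degB : ∀ y → degreeB edgeTree y ≡ e y
      degB y with y ≟ᶠ j
      ... | yes refl = trans (unique⇒count≡1 (λ x → entry edgeTree x j) i ij λ x xj → proj₁ (edge⇒ x j xj)) (sym ej≡1)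
      ... | no y≢j   = trans (no-edge⇒count≡0 (λ x → entry edgeTree x y) λ x xy → y≢j (proj₂ (edge⇒ x y xy)))
          (sym (e≡0 y y≢j))

    edgeTree-unique : ∀ {r} → PlaneTree d e r → edgeTree ≡ r
    edgeTree-unique {r} t = raw-ext
      (λ x y → T⇔⇒≡ (λ xy → let x≡i , y≡j = edge⇒ x y xy in subst₂ (Edge r) (sym x≡i) (sym y≡j) ij′)
                     (λ xy → let x≡i , y≡j = only x y xy in subst₂ (Edge edgeTree) (sym x≡i) (sym y≡j) ij))
      (λ x y → trans (nextW≡id x y) (sym (cyclic-singleton (edge? r x) (cyclicW t x)
        (λ y z xy xz → trans (proj₂ (only x y xy)) (sym (proj₂ (only x z xz)))) y)))
      (λ y x → trans (nextB≡id y x) (sym (cyclic-singleton (λ x → edge? r x y) (cyclicB t y)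
        (λ x z xy zy → trans (proj₁ (only x y xy)) (sym (proj₁ (only z y zy)))) x)))
      where
      only : ∀ x y → Edge r x y → x ≡ i × y ≡ j
      only x y xy =
          decidable-stable (x ≟ᶠ i) (λ x≢i → count≢0 (entry r x) y xy (trans (degreeW≡ t x) (d≡0 x x≢i)))
        , decidable-stable (y ≟ᶠ j) (λ y≢j →
            count≢0 (λ x → entry r x y) x xy (trans (degreeB≡ t y) (e≡0 y y≢j)))
      ij′ : Edge r i j
      ij′ =
        let y , iy = count-witness (entry r i) (λ eq → 1+n≢0 (trans (sym di≡1) (trans (sym (degreeW≡ t i)) eq))) in
        subst (Edge r i) (proj₂ (only i y iy)) iy

  -- The edge must join the only two vertices of positive degree, and rotations on at most one
  -- neighbour are identities, so no choice remains.
  singleEdge-↔ : Fin 1 ↔ PlaneTrees d e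
  singleEdge-↔ = mk↔ₛ′ (λ _ → edgeTree , [ edgeTree-plane ]) (λ _ → zero)
    (λ (r , [ t ]) → refinement-≡ (recompute (raw-≟ edgeTree r) (edgeTree-unique t)))
    (λ { zero → refl })

-- Enumeration of trees with prescribed degrees

sum≡1⇒others≡0 : ∀ {n} (d : Fin n → ℕ) i → d i ≡ 1 → sum d ≡ 1 → ∀ x → x ≢ i → d x ≡ 0
sum≡1⇒others≡0 d i di≡1 eq x x≢i = trans (sym (lower-other d i x x≢i))
  (n≤0⇒n≡0 (subst (lower d i x ≤_) (suc-injective (trans (sym (sum-lower d i di≡1)) eq)) (sum-pos (lower d i) x)))

-- The parameters are shifted by one, so that the factorials need no subtraction: there are `suc w`
-- white and `suc b` black active vertices, hence `suc (w + b)` edges.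
Enumeration : ∀ n m → ℕ → ℕ → Set
Enumeration n m w b = ∀ (d : Fin n → ℕ) (e : Fin m → ℕ) → support d ≡ suc w → support e ≡ suc b →
  sum d ≡ suc (w + b) → sum e ≡ suc (w + b) → Fin (w ! * b !) ↔ PlaneTrees d e

enumeration-swap : ∀ {n m w b} → Enumeration n m w b → Enumeration m n b w
enumeration-swap {w = w} {b} enum d e suppd suppe sumd sume = Fin-subst (*-comm (w !) (b !))
  (↔-trans (enum e d suppe suppd (trans sume (cong suc (+-comm b w))) (trans sumd (cong suc (+-comm b w))))
      planeTrees-swap)

-- Trees are sorted by the neighbour `j` of the leaf `i`. The corner counts `e j ∸ 1` add up to
-- `suc w`, which turns `w !` into `(suc w) !`.
enumerate-whiteLeaf : ∀ {n m w b} → Enumeration n m w b → ∀ (d : Fin n → ℕ) (e : Fin m → ℕ) i → d i ≡ 1 →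
  support d ≡ suc (suc w) → support e ≡ suc b → sum d ≡ suc (suc w + b) → sum e ≡ suc (suc w + b) →
  Fin ((suc w) ! * b !) ↔ PlaneTrees d e
enumerate-whiteLeaf {n} {m} {w} {b} enum d e i di≡1 suppd suppe sumd sume =
  Fin-subst total (↔-trans (Fin-Σ c neighbour) (partition (λ j r → Edge r i j) (λ j r → edge? r i j)
    (λ r t → count-witness (entry r i) λ eq → 1+n≢0 (trans (sym di≡1) (trans (sym (degreeW≡ t i)) eq)))
    (λ r t j j′ ij ij′ → count≡1⇒unique (entry r i) j′ (trans (degreeW≡ t i) di≡1) ij′ j ij)))
  where
  c : Fin m → ℕ
  c j = (e j ∸ 1) * (w ! * b !)
  total : sum c ≡ (suc w) ! * b !
  total = trans (sum-*ʳ (λ j → e j ∸ 1) (w ! * b !))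
      (trans (cong (_* (w ! * b !)) corner-count) (sym (*-assoc (suc w) (w !) (b !))))
    where
    open ≡-Reasoning
    corner-count : sum (λ j → e j ∸ 1) ≡ suc w
    -- Edges minus active black vertices: (w + b + 2) - (b + 1).
    corner-count = +-cancelʳ-≡ (suc b) _ _ (begin
      sum (λ j → e j ∸ 1) + suc b     ≡⟨ cong (sum (λ j → e j ∸ 1) +_) suppe ⟨
      sum (λ j → e j ∸ 1) + support e ≡⟨ sum-pred e ⟩
      sum e                           ≡⟨ sume ⟩
      suc (suc w + b)                 ≡⟨ +-suc (suc w) b ⟨
      suc w + suc b                   ∎)
  Through : Fin m → Set
  Through j = Refinement (Raw n m) λ r → PlaneTree d e r × Edge r i j
  neighbour : ∀ j → Fin (c j) ↔ Through j
  neighbour j with e j in ej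
  ... | zero = Fin-0 λ (r , [ tij ]) → ⊥-recompute
    (count≢0 (λ x → entry r x j) i (proj₂ tij) (trans (degreeB≡ (proj₁ tij) j) ej))
  -- Here `i` and `j` would form an isolated edge, but the support of `d` contains a second white
  -- vertex.
  ... | suc zero = Fin-0 λ (r , [ tij ]) → ⊥-recompute (two-leaves (proj₁ tij) (proj₂ tij))
    where
    two-leaves : ∀ {r} → PlaneTree d e r → ¬ Edge r i j
    two-leaves {r} t ij =
      let x , x≢i , dx≢0 = support-another d i di≡1 suppd
          y , xy = count-witness (entry r x) λ eq → dx≢0 (trans (sym (degreeW≡ t x)) eq)
      in x≢i (proj₁ (isolated-edge (isTree t) ij (count≡1⇒unique (entry r i) j (trans (degreeW≡ t i) di≡1) ij)
                                   (count≡1⇒unique (λ x → entry r x j) i (trans (degreeB≡ t j) ej) ij) x y xy))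
  ... | suc (suc k) = Fin-subst (*-comm (w ! * b !) (suc k))
      (↔-trans (Fin-Σ-const smaller corners) (leaf-removal di≡1 ej))
    where
    smaller : Fin (w ! * b !) ↔ PlaneTrees (lower d i) (lower e j)
    -- The white support loses `i`, the black one keeps `j`, and both sums lose the deleted edge.
    smaller = enum (lower d i) (lower e j)
      (suc-injective (trans (sym (support-lower-1 d i di≡1)) suppd)) (trans (sym (support-lower-2 e j ej)) suppe)
      (suc-injective (trans (sym (sum-lower d i di≡1)) sumd)) (suc-injective (trans (sym (sum-lower e j ej)) sume))
    corners : ∀ (t : PlaneTrees (lower d i) (lower e j)) → Fin (suc k) ↔ Σ (Fin n) λ z → Edge (value t) z j
    corners (r , [ t ]) =
      Fin-subst (recompute (_ ≟ _) (trans (degreeB≡ t j) (lower-self e j ej))) (Fin-count λ z → entry r z j)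

enumerate-white : ∀ {n m w b} → b ≤ suc w → Enumeration n m w b → Enumeration n m (suc w) b
enumerate-white {w = w} {b} b≤w enum d e suppd suppe sumd sume =
  let i , di≡1 = sum<2*support⇒∃1 d (subst₂ _<_ (sym sumd) (cong₂ _+_ (sym suppd) (sym suppd)) lt)
  in enumerate-whiteLeaf enum d e i di≡1 suppd suppe sumd sume
  where
  -- The inequality w + b + 2 < 2(w + 2) amounts to `b ≤ suc w`.
  lt : suc (suc w + b) < suc (suc w) + suc (suc w)
  lt = s≤s (s≤s (subst (suc (w + b) ≤_) (sym (+-suc w (suc w))) (s≤s (+-monoʳ-≤ w b≤w))))

-- The leaf is taken in a colour with at least as many active vertices as the other, where the
-- degree sum guarantees one; black leaves are handled by exchanging the colours.
enumerate : ∀ n m w b → Enumeration n m w b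
enumerate n m zero zero d e suppd suppe sumd sume =
  let i , di≡1 = unit-leaf d suppd sumd
      j , ej≡1 = unit-leaf e suppe sume
  in SingleEdge.singleEdge-↔ di≡1 ej≡1 (sum≡1⇒others≡0 d i di≡1 sumd) (sum≡1⇒others≡0 e j ej≡1 sume)
  where
  unit-leaf : ∀ {n} (d : Fin n → ℕ) → support d ≡ 1 → sum d ≡ 1 → ∃ λ i → d i ≡ 1
  unit-leaf d supp≡ sum≡ =
      sum<2*support⇒∃1 d (subst₂ _<_ (sym sum≡) (cong₂ _+_ (sym supp≡) (sym supp≡)) (s≤s (s≤s z≤n)))
enumerate n m (suc w) zero    = enumerate-white z≤n (enumerate n m w zero)
enumerate n m zero    (suc b) = enumeration-swap (enumerate-white z≤n (enumeration-swap (enumerate n m zero b)))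
enumerate n m (suc w) (suc b) with ≤-total b w
... | inj₁ b≤w = enumerate-white (s≤s b≤w) (enumerate n m w (suc b))
... | inj₂ w≤b = enumeration-swap (enumerate-white (s≤s w≤b) (enumeration-swap (enumerate n m (suc w) b)))

-- Weak compositions and their number

multichoose : ℕ → ℕ → ℕ
multichoose zero    zero    = 1
multichoose zero    (suc s) = 0
multichoose (suc n) zero    = multichoose n zero
multichoose (suc n) (suc s) = multichoose n (suc s) + multichoose (suc n) s

multichoose-zero : ∀ n → multichoose n 0 ≡ 1
multichoose-zero zero    = refl
multichoose-zero (suc n) = multichoose-zero n

-- Thus `multichoose (suc n) s` is the binomial coefficient C(n + s, s), here with denominators
-- cleared. In the main case the two terms of the recursion give `suc n` and `suc s` times the same
-- factorial.
multichoose-! : ∀ n s → multichoose (suc n) s * (n ! * s !) ≡ (n + s) !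
multichoose-! n zero rewrite multichoose-zero n | +-identityʳ n = trans (+-identityʳ _) (*-identityʳ (n !))
multichoose-! zero (suc s) = trans (scale (multichoose 1 s) (s !) s) (cong (suc s *_) (multichoose-! 0 s))
  where
  scale : ∀ a x s → a * (1 * (suc s * x)) ≡ suc s * (a * (1 * x))
  scale = solve-∀
multichoose-! (suc n) (suc s) = begin
  (a + b) * (suc n * n ! * (suc s * s !))                             ≡⟨ split a b n s (n !) (s !) ⟩
  suc n * (a * (n ! * (suc s) !)) + suc s * (b * ((suc n) ! * s !))
    ≡⟨ cong₂ (λ x y → suc n * x + suc s * y) (multichoose-! n (suc s)) (multichoose-! (suc n) s) ⟩
  suc n * (n + suc s) ! + suc s * (suc n + s) !
    ≡⟨ cong (λ k → suc n * (n + suc s) ! + suc s * k !) (sym (+-suc n s)) ⟩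
  suc n * (n + suc s) ! + suc s * (n + suc s) !
      ≡⟨ *-distribʳ-+ ((n + suc s) !) (suc n) (suc s) ⟨
  (suc n + suc s) !                                                   ∎
  where
  open ≡-Reasoning
  a = multichoose (suc n) (suc s)
  b = multichoose (suc (suc n)) s
  split : ∀ a b n s x y → (a + b) * (suc n * x * (suc s * y)) ≡ suc n * (a * (x * (suc s * y))) +
    suc s * (b * (suc n * x * y))
  split = solve-∀

Composition : ℕ → ℕ → Set
Composition n s = Refinement (Vec ℕ n) λ v → sum (lookup v) ≡ s

-- A leading part 0 is dropped and a positive one is lowered by one, which is the recursion of
-- `multichoose`.
Fin-Composition : ∀ n s → Fin (multichoose n s) ↔ Composition n s
Fin-Composition zero zero    = mk↔ₛ′ (λ _ → [] , [ refl ]) (λ _ → zero) (λ { ([] , _) → refl }) (λ { zero → refl })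
Fin-Composition zero (suc s) = Fin-0 λ { ([] , [ () ]) }
Fin-Composition (suc n) zero = ↔-trans (Fin-Composition n zero) (mk↔ₛ′
  (λ (v , [ p ]) → 0 ∷ v , [ p ])
  (λ { (zero ∷ v , [ p ]) → v , [ p ] ; (suc _ ∷ _ , [ () ]) })
  (λ { (zero ∷ v , [ p ]) → refl ; (suc _ ∷ _ , [ () ]) })
  (λ { (_ , [ _ ]) → refl }))
Fin-Composition (suc n) (suc s) =
    ↔-trans +↔⊎ (↔-trans (Fin-Composition n (suc s) ⊎-cong Fin-Composition (suc n) s) (mk↔ₛ′
  (λ { (inj₁ (v , [ p ])) → 0 ∷ v , [ p ] ; (inj₂ (a ∷ v , [ p ])) → suc a ∷ v , [ cong suc p ] })
  (λ { (zero ∷ v , [ p ]) → inj₁ (v , [ p ]) ; (suc a ∷ v , [ p ]) → inj₂ (a ∷ v , [ suc-injective p ]) })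
  (λ { (zero ∷ v , [ p ]) → refl ; (suc a ∷ v , [ p ]) → refl })
  (λ { (inj₁ (v , [ p ])) → refl ; (inj₂ (a ∷ v , [ p ])) → refl })))

-- The degrees minus one over the white vertices sum to m − 1, those over the black vertices to n − 1.
excess : ∀ {n} → Vec ℕ n → Fin n → ℕ
excess v = suc ∘ lookup v

-- From degree sequences to all plane labelled bipartite trees

module _ {n m : ℕ} where

  private
    N = suc n
    M = suc m

  Sequences : Set
  Sequences = Composition N m × Composition M n

  TreesWith : Sequences → Set
  TreesWith (v , u) = PlaneTrees (excess (value v)) (excess (value u))

  Fin-TreesWith : ∀ s → Fin (n ! * m !) ↔ TreesWith s
  Fin-TreesWith ((v , [ p ]) , (u , [ q ])) = enumerate N M n m (excess v) (excess u)
    (support-all (excess v) λ _ → 1+n≢0) (support-all (excess u) λ _ → 1+n≢0)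
    (trans (sum-suc (lookup v)) (cong (suc n +_) (recompute (_ ≟ _) p)))
    (trans (sum-suc (lookup u)) (trans (cong (suc m +_) (recompute (_ ≟ _) q)) (cong suc (+-comm m n))))

  module _ {r : Raw N M} where

    planeTree⇒tree : ∀ v u → PlaneTree (excess v) (excess u) r → IsPlaneBipartiteTree r
    planeTree⇒tree v u t =
        ((λ x y → SupportTree.connected (isTree t) (active x) (active y)) , SupportTree.acyclic (isTree t))
      , cyclicW t , cyclicB t
      where
      active : ∀ x → Active r x
      active (inj₁ i) = let j , ij = count-witness (entry r i) (λ eq → 1+n≢0 (trans (sym (degreeW≡ t i)) eq)) in
          inj₂ j , ij
      active (inj₂ j) = let i , ij = count-witness (λ i → entry r i j) (λ eq → 1+n≢0 (trans (sym (degreeB≡ t j)) eq)) in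
          inj₁ i , ij

    module _ (tree : IsPlaneBipartiteTree r) where

      private
        connected = proj₁ (proj₁ tree)

        first-step : ∀ {x y} → Walk (Adj r) x y → x ≢ y → Active r x
        first-step []      x≢y = ⊥-elim (x≢y refl)
        first-step (a ∷ _) _   = _ , a

        -- Both colours occur, so a walk to a vertex of the other colour is not empty, and its first
        -- step is an edge at `i`.
        edgeW : ∀ i → ∃ (Edge r i)
        edgeW i with first-step (connected (inj₁ i) (inj₂ zero)) (λ ())
        ... | inj₂ j , ij = j , ij

        edgeB : ∀ j → ∃ λ i → Edge r i j
        edgeB j with first-step (connected (inj₂ j) (inj₁ zero)) (λ ())
        ... | inj₁ i , ij = i , ij

        support-tree : SupportTree r
        support-tree = supportTree (λ _ _ → connected _ _) (proj₂ (proj₁ tree))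

      degreeW≢0 : ∀ i → degreeW r i ≢ 0
      degreeW≢0 i = let j , ij = edgeW i in count≢0 (entry r i) j ij

      degreeB≢0 : ∀ j → degreeB r j ≢ 0
      degreeB≢0 j = let i , ij = edgeB j in count≢0 (λ i → entry r i j) i ij

      tree-degree-sums : suc (sum (degreeW r)) ≡ N + M × suc (sum (degreeB r)) ≡ N + M
      tree-degree-sums = trans (proj₁ sums) vertices , trans (proj₂ sums) vertices
        where
        sums = degree-sums (suc (degreeTotal r)) r ≤-refl support-tree (proj₂ (edgeW zero))
        vertices = cong₂ _+_ (support-all _ degreeW≢0) (support-all _ degreeB≢0)

      tree⇒planeTree : ∀ v u → (∀ i → lookup v i ≡ pred (degreeW r i)) → (∀ j → lookup u j ≡ pred (degreeB r j)) →
        PlaneTree (excess v) (excess u) r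
      tree⇒planeTree v u v≡ u≡ = record
        { isTree   = support-tree
        ; cyclicW  = proj₁ (proj₂ tree)
        ; cyclicB  = proj₂ (proj₂ tree)
        ; degreeW≡ = λ i → sym (trans (cong suc (v≡ i)) (suc-pred _ {{≢-nonZero (degreeW≢0 i)}}))
        ; degreeB≡ = λ j → sym (trans (cong suc (u≡ j)) (suc-pred _ {{≢-nonZero (degreeB≢0 j)}}))
        }

  excess-sum : ∀ {k s} {d : Fin (suc k) → ℕ} → (∀ i → d i ≢ 0) → suc (sum d) ≡ suc k + suc s →
    sum (lookup (tabulate (pred ∘ d))) ≡ s
  excess-sum {k} {s} {d} d≢0 eq = +-cancelˡ-≡ (suc k) _ _ (begin
    suc k + sum (lookup (tabulate (pred ∘ d))) ≡⟨ sum-suc (lookup (tabulate (pred ∘ d))) ⟨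
    sum (suc ∘ lookup (tabulate (pred ∘ d)))   ≡⟨ sum-cong-≗ (λ i →
      trans (cong suc (lookup∘tabulate (pred ∘ d) i)) (suc-pred (d i) {{≢-nonZero (d≢0 i)}})) ⟩
    sum d                                      ≡⟨ suc-injective (trans eq (+-suc (suc k) s)) ⟩
    suc k + s                                  ∎)
    where open ≡-Reasoning

  -- The two compositions carry no extra information, since a tree determines its degrees;
  -- `recompute` recovers them from the erased degree proofs.
  byDegrees : Σ Sequences TreesWith ↔ PlaneLabelledBipartiteTree N M
  byDegrees = mk↔ₛ′ to from (λ _ → refl) λ (((v , [ p ]) , (u , [ q ])) , (r , [ t ])) →
    sequences-≡ (recompute (Vec-≡-dec _≟_ _ _) (excess-≡ (degreeW≡ t)))
        (recompute (Vec-≡-dec _≟_ _ _) (excess-≡ (degreeB≡ t)))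
    where
    to : Σ Sequences TreesWith → PlaneLabelledBipartiteTree N M
    to (((v , _) , (u , _)) , (r , [ t ])) = r , [ planeTree⇒tree v u t ]
    from : PlaneLabelledBipartiteTree N M → Σ Sequences TreesWith
    from (r , [ t ]) =
      ( (tabulate (pred ∘ degreeW r) , [ excess-sum (degreeW≢0 t) (proj₁ (tree-degree-sums t)) ])
      , (tabulate (pred ∘ degreeB r)
        , [ excess-sum (degreeB≢0 t) (trans (proj₂ (tree-degree-sums t)) (+-comm N M)) ]))
      , (r , [ tree⇒planeTree t (tabulate (pred ∘ degreeW r)) (tabulate (pred ∘ degreeB r))
          (lookup∘tabulate (pred ∘ degreeW r)) (lookup∘tabulate (pred ∘ degreeB r)) ])
    excess-≡ : ∀ {k} {d : Fin k → ℕ} {v : Vec ℕ k} → d ≗ excess v → tabulate (pred ∘ d) ≡ v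
    excess-≡ {d = d} d≗ = lookup-ext λ i → trans (lookup∘tabulate (pred ∘ d) i) (cong pred (d≗ i))
    sequences-≡ : ∀ {v v′ : Composition N m} {u u′ : Composition M n} {r}
      .{t : PlaneTree (excess (value v)) (excess (value u)) r}
          .{t′ : PlaneTree (excess (value v′)) (excess (value u′)) r} →
      value v ≡ value v′ → value u ≡ value u′ →
      _≡_ {A = Σ Sequences TreesWith} ((v , u) , (r , [ t ])) ((v′ , u′) , (r , [ t′ ]))
    sequences-≡ {v = _ , _} {_ , _} {_ , _} {_ , _} refl refl = refl

-- Both `a * f` and `b * f` equal `(n + m) !`, where `f` is the denominator; the square is therefore
-- `a * b * f * f` and the division is exact.
treeCount-suc : ∀ n m → multichoose (suc n) m * multichoose (suc m) n * (n ! * m !) ≡ treeCount (suc n) (suc m)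
treeCount-suc n m = sym (begin
  treeCount (suc n) (suc m)   ≡⟨ cong (λ x → _/_ x (n ! * m !) {{n !* m !≢0}}) square ⟩
  _/_ (a * b * f * f) f {{n !* m !≢0}} ≡⟨ m*n/n≡m (a * b * f) f {{n !* m !≢0}} ⟩
  a * b * f                   ∎)
  where
  open ≡-Reasoning
  a = multichoose (suc n) m
  b = multichoose (suc m) n
  f = n ! * m !
  regroup : ∀ a b x y → a * (x * y) * (b * (y * x)) ≡ a * b * (x * y) * (x * y)
  regroup = solve-∀
  square : ((suc n + suc m ∸ 2) !) ^ 2 ≡ a * b * f * f
  square = begin
    ((suc n + suc m ∸ 2) !) ^ 2              ≡⟨ cong (λ k → ((k ∸ 1) !) ^ 2) (+-suc n m) ⟩
    (n + m) ! * ((n + m) ! * 1)              ≡⟨ cong ((n + m) ! *_) (*-identityʳ _) ⟩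
    (n + m) ! * (n + m) !
        ≡⟨ cong₂ _*_ (multichoose-! n m) (trans (multichoose-! m n) (cong _! (+-comm m n))) ⟨
    a * (n ! * m !) * (b * (m ! * n !))      ≡⟨ regroup a b (n !) (m !) ⟩
    a * b * f * f                            ∎

theorem2p1 : (n m : ℕ) → 1 ≤ n → 1 ≤ m →
    Fin (treeCount n m) ↔ PlaneLabelledBipartiteTree n m
theorem2p1 (suc n) (suc m) _ _ = Fin-subst (treeCount-suc n m)
  (↔-trans (Fin-Σ-const (↔-trans *↔× (Fin-Composition (suc n) m ×-cong Fin-Composition (suc m) n)) Fin-TreesWith)
      byDegrees)
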